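{- Let $\mathcal{H}=(V(\mathcal{H}),E(\mathcal{H}))$ be an $m$-uniform hypergraph with $n$ vertices and let $j\in V(\mathcal{H})$. Then the subgraph centrality of $j$ in $\mathcal{H}$ is $$C(j)=\sum_{d=0}^{\infty}\frac{\mu_{d}(j)}{d!},$$ where $\mu_0(j)=(m-1)^{n-1}$ and, for every integer $d\geq 1$, $$\mu_{d}(j)=(m-1)^{n-1}\sum_{F\in\mathcal{F}_{d}^{(j)}(\mathcal{H})}\frac{b(F)}{c(F)}\,|\mathbf{W}(F,j)|.$$ Here $b(F)$ is the product of the factorials of the multiplicities of all the arcs in $D(F)$, $c(F)$ is the product of the factorials of the outdegrees of all the vertices in $D(F)$, and $\mathbf{W}(F,j)$ is the set of all Eulerian closed walks of $D(F)$ starting and ending at the vertex $j$.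
   Context: Write $[n]=\{1,\dots,n\}$. A hypergraph $\mathcal{H}=(V(\mathcal{H}),E(\mathcal{H}))$ (here with $V(\mathcal{H})=[n]$, and $E(\mathcal{H})$ a set of subsets of $V(\mathcal{H})$) is $m$-uniform if $|e|=m\geq 2$ for every $e\in E(\mathcal{H})$; a word $i_1i_2\cdots i_m$ is said to belong to $E(\mathcal{H})$ if $\{i_1,\dots,i_m\}\in E(\mathcal{H})$. Its adjacency tensor $\mathcal{A}_{\mathcal{H}}=(h_{\alpha})_{\alpha\in[n]^m}$ has $h_\alpha=\frac{1}{(m-1)!}$ if $\alpha\in E(\mathcal{H})$ and $h_\alpha=0$ otherwise. Definition of $\mu_d(j)$ and $C(j)$. Let $A=(a_{ij})$ be an $n\times n$ auxiliary matrix whose entries are independent variables, and for $i\in[n]$, $\alpha=i_2\cdots i_m\in[n]^{m-1}$ put $\frac{\partial}{\partial a_{i\alpha}}=\frac{\partial}{\partial a_{ii_2}}\cdots\frac{\partial}{\partial a_{ii_m}}$. For $j\in[n]$ and an integer $d\ge 0$, $$\mu_{d}(j)=(m-1)^{n-1}\sum_{d_1+\cdots+d_n=d}\ \prod_{i=1}^{n}\frac{1}{(d_i(m-1))!}\Big(\sum_{\alpha_i\in[n]^{m-1}}h_{i\alpha_i}\frac{\partial}{\partial a_{i\alpha_i}}\Big)^{d_i}\,(A^{d(m-1)})_{jj},$$ the sum being over nonnegative integers $d_1,\dots,d_n$. The subgraph centrality of the vertex $j$ is $C(j)=\sum_{d=0}^{\infty}\frac{\mu_d(j)}{d!}$ with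 this $\mu_d(j)$. Multi-digraphs. For $d\geq 1$ let $\mathcal{F}_d=\{(i_1\alpha_1,\dots,i_d\alpha_d)\mid 1\le i_1\le\cdots\le i_d\le n,\ \alpha_k\in[n]^{m-1},\ k=1,\dots,d\}$. For $F=(i_1\alpha_1,\dots,i_d\alpha_d)\in\mathcal{F}_d$ with $\alpha_k=j_1^{(k)}\cdots j_{m-1}^{(k)}$, let $\widetilde{E}(F)$ be the multiset of arcs consisting of $(i_k,j_1^{(k)}),\dots,(i_k,j_{m-1}^{(k)})$ for $k=1,\dots,d$ (multiplicities added), and let $D(F)$ be the multi-digraph with arc multiset $\widetilde{E}(F)$ and with vertex set the set of endpoints of these arcs. Let $\omega(u,v)$ be the multiplicity of the arc $(u,v)$ in $D(F)$, and let $\widehat{D}(F)$ be the digraph obtained from $D(F)$ by removing duplicate arcs. Outdegrees in $D(F)$ count arcs with multiplicity. An Eulerian closed walk of $D(F)$ is a closed walk that uses each arc $(u,v)$ of $\widehat{D}(F)$ exactly $\omega(u,v)$ times (so parallel arcs are not distinguished; a walk is determined by its sequence of vertices, including its starting vertex). $D(F)$ is Eulerian if it has Eulerian closed walks. A word $i_1\cdots i_s$ is in ascending order if $i_1\le\cdots\le i_s$. Let $\mathcal{F}_d(\mathcal{H})$ be the set of $(i_1\alpha_1,\dots,i_d\alpha_d)\in\mathcal{F}_d$ such that $i_k\alpha_k\in E(\mathcal{H})$ and $\alpha_k$ is in ascending order for all $k=1,\dots,d$, and let $\mathcal{F}_d^{(j)}(\mathcal{H})$ be the set of $F\in\mathcal{F}_d(\mathcal{H})$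 such that $D(F)$ is Eulerian and contains the vertex $j$. -}

module Defs where

open import Data.Bool.Base using (if_then_else_)
open import Data.Fin.Base using (Fin) renaming (_≤_ to _≤ᶠ_)
open import Data.Fin.Properties using () renaming (_≟_ to _≟ᶠ_; _≤?_ to _≤ᶠ?_; all? to allᶠ?)
open import Data.Fin.Subset using (Subset; ⁅_⁆; ⋃; ∣_∣)
open import Data.Integer.Base using (+_)
open import Data.List.Base using (List; []; _∷_; [_]; _++_; map; concat; concatMap;
  cartesianProduct; cartesianProductWith; foldr; filter; length; allFin; upTo)
open import Data.List.Membership.Propositional using (_∈_; find; lose)
open import Data.List.Membership.Propositional.Properties using (∈-allFin; ∈-cartesianProductWith⁺)
open import Data.List.Relation.Unary.Any using (Any; here; any?)
open import Data.List.Relation.Unary.All using (universal)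
import Data.List.Relation.Unary.All.Properties as All
open import Data.Nat.Base using (ℕ; zero; suc; _+_; _*_; _∸_; _^_; _!; _≤_; NonZero)
open import Data.Nat.GeneralisedArithmetic using (fold)
open import Data.Nat.ListAction using (product)
open import Data.Nat.ListAction.Properties using (product≢0)
import Data.Nat.Properties as ℕ
open import Data.Product.Base using (_×_; _,_; ∃; ∃-syntax; proj₁)
open import Data.Product.Properties using (≡-dec)
open import Data.Rational.Base as ℚ using (ℚ; 0ℚ; 1ℚ; _/_)
open import Data.Sum.Base using (_⊎_)
open import Data.Vec.Base as Vec using (Vec; []; _∷_; lookup; head; last; toList)
open import Data.Vec.Relation.Unary.All as Vecᴬ using ()
open import Data.Vec.Relation.Unary.Linked using (Linked; linked?)
open import Level using (0ℓ)
open import Relation.Binary.Definitions using (DecidableEquality)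
open import Relation.Binary.PropositionalEquality using (_≡_; refl)
open import Relation.Nullary.Decidable using (Dec; does; map′; _×-dec_; _⊎-dec_)
open import Relation.Unary using (Pred; Decidable)

vectors : ∀ {A : Set} → List A → ∀ k → List (Vec A k)
vectors xs zero    = [ [] ]
vectors xs (suc k) = cartesianProductWith _∷_ xs (vectors xs k)

∈-vectors : ∀ {A : Set} {xs : List A} → (∀ x → x ∈ xs) →
            ∀ {k} (v : Vec A k) → v ∈ vectors xs k
∈-vectors all∈ []      = here refl
∈-vectors all∈ (x ∷ v) = ∈-cartesianProductWith⁺ _∷_ (all∈ x) (∈-vectors all∈ v)

words : ∀ n k → List (Vec (Fin n) k)
words n = vectors (allFin n)

any-word? : ∀ {n k} {P : Pred (Vec (Fin n) k) 0ℓ} → Decidable P → Dec (∃ P)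
any-word? {n} {k} P? =
  map′ (λ any → let w , _ , Pw = find any in w , Pw)
       (λ (w , Pw) → lose (∈-vectors ∈-allFin w) Pw)
       (any? P? (words n k))

-- The vectors (d₁ , … , dₙ) of natural numbers with d₁ + ⋯ + dₙ = d.
compositions : ∀ n → ℕ → List (Vec ℕ n)
compositions n d = filter (λ ds → Vec.sum ds ℕ.≟ d) (vectors (upTo (suc d)) n)

1/_! : ℕ → ℚ
1/ k ! = (+ 1 / (k !)) {{k ℕ.!≢0}}

fromℕ : ℕ → ℚ
fromℕ k = + k / 1

sumℚ : List ℚ → ℚ
sumℚ = foldr ℚ._+_ 0ℚ

-- Real numbers, as Cauchy sequences of rationals.
record ℝ : Set where
  field
    approx : ℕ → ℚ
    cauchy : ∀ ε → 0ℚ ℚ.< ε →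
             ∃[ N ] (∀ k l → N ≤ k → N ≤ l → ℚ.∣ approx k ℚ.- approx l ∣ ℚ.< ε)

partialSum : (ℕ → ℚ) → ℕ → ℚ
partialSum a zero    = 0ℚ
partialSum a (suc k) = partialSum a k ℚ.+ a k

-- The real number x is the sum of the series a₀ + a₁ + ⋯ : the sequence of
-- partial sums and the sequence representing x have the same limit.
_SumsTo_ : (ℕ → ℚ) → ℝ → Set
a SumsTo x = ∀ ε → 0ℚ ℚ.< ε →
             ∃[ N ] (∀ k → N ≤ k → ℚ.∣ partialSum a k ℚ.- ℝ.approx x k ∣ ℚ.< ε)

-- Monomials in the n² independent variables a i j; e i j is the exponent of a i j.
Monomial : ℕ → Set
Monomial n = Fin n → Fin n → ℕ

_≟ᴹ_ : ∀ {n} (e f : Monomial n) → Dec (∀ i j → e i j ≡ f i j)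
e ≟ᴹ f = allᶠ? λ i → allᶠ? λ j → e i j ℕ.≟ f i j

varExponent : ∀ {n} → Fin n → Fin n → Monomial n
varExponent i j u v = if does ((i ≟ᶠ u) ×-dec (j ≟ᶠ v)) then 1 else 0

-- A formal sum of terms. The same monomial may occur in several terms, so
-- polynomials are compared by _≈_ below rather than by _≡_.
Polynomial : ℕ → Set
Polynomial n = List (ℚ × Monomial n)

coeff : ∀ {n} → Polynomial n → Monomial n → ℚ
coeff p e = sumℚ (map (λ (q , f) → if does (f ≟ᴹ e) then q else 0ℚ) p)

infix 4 _≈_
_≈_ : ∀ {n} → Polynomial n → Polynomial n → Set
p ≈ q = ∀ e → coeff p e ≡ coeff q e

const : ∀ {n} → ℚ → Polynomial n
const q = [ (q , λ _ _ → 0) ]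

var : ∀ {n} → Fin n → Fin n → Polynomial n
var i j = [ (1ℚ , varExponent i j) ]

sumᴾ : ∀ {n} → List (Polynomial n) → Polynomial n
sumᴾ = concat

infixl 7 _*ᴾ_
_*ᴾ_ : ∀ {n} → Polynomial n → Polynomial n → Polynomial n
_*ᴾ_ = cartesianProductWith λ (q , e) (r , f) → q ℚ.* r , λ i j → e i j + f i j

infixr 7 _·_
_·_ : ∀ {n} → ℚ → Polynomial n → Polynomial n
q · p = map (λ (r , e) → q ℚ.* r , e) p

-- The partial derivative with respect to a i j. When a i j does not occur in
-- a monomial, the truncated subtraction is harmless: the coefficient is 0.
∂ : ∀ {n} → Fin n → Fin n → Polynomial n → Polynomial n
∂ i j = map λ (q , e) → q ℚ.* fromℕ (e i j) , λ u v → e u v ∸ varExponent i j u v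

-- ∂/∂a i α = ∂/∂a i i₂ ⋯ ∂/∂a i iₘ for α = i₂ ⋯ iₘ.
∂ʷ : ∀ {n k} → Fin n → Vec (Fin n) k → Polynomial n → Polynomial n
∂ʷ i α p = Vec.foldr′ (∂ i) p α

Matrix : ℕ → Set
Matrix n = Fin n → Fin n → Polynomial n

_*ᴹ_ : ∀ {n} → Matrix n → Matrix n → Matrix n
(M *ᴹ N) i j = sumᴾ (map (λ l → M i l *ᴾ N l j) (allFin _))

identity : ∀ {n} → Matrix n
identity i j = if does (i ≟ᶠ j) then const 1ℚ else const 0ℚ

_^ᴹ_ : ∀ {n} → Matrix n → ℕ → Matrix n
M ^ᴹ zero  = identity
M ^ᴹ suc k = M *ᴹ (M ^ᴹ k)

-- Uniform hypergraphs on the vertex set Fin n.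
record UniformHypergraph (n m : ℕ) : Set₁ where
  field
    Edge    : Pred (Subset n) 0ℓ
    edge?   : Decidable Edge
    2≤m     : 2 ≤ m
    uniform : ∀ e → Edge e → ∣ e ∣ ≡ m

letters : ∀ {n k} → Vec (Fin n) k → Subset n
letters w = ⋃ (map ⁅_⁆ (toList w))

module _ {n m : ℕ} (H : UniformHypergraph n m) where
  open UniformHypergraph H

  -- The entry of the adjacency tensor at the index i α, where α has length m − 1.
  h : Fin n → Vec (Fin n) (m ∸ 1) → ℚ
  h i α = if does (edge? (letters (i ∷ α))) then 1/ (m ∸ 1) ! else 0ℚ

  -- The differential operator Σ_α h_{iα} ∂/∂a_{iα}.
  tensorDerivative : Fin n → Polynomial n → Polynomial n
  tensorDerivative i p = sumᴾ (map (λ α → h i α · ∂ʷ i α p) (words n (m ∸ 1)))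

  -- μ_d(j), as an element of the polynomial ring in the a i j.
  μ : ℕ → Fin n → Polynomial n
  μ d j = fromℕ ((m ∸ 1) ^ (n ∸ 1)) · sumᴾ (map summand (compositions n d))
    where
    summand : Vec ℕ n → Polynomial n
    summand ds =
      foldr (λ i p → 1/ (lookup ds i * (m ∸ 1)) ! · fold p (tensorDerivative i) (lookup ds i))
            ((var ^ᴹ (d * (m ∸ 1))) j j)
            (allFin n)

  -- C is the subgraph centrality C(j): the polynomials μ_d(j) are constant,
  -- and C is the sum of the series with terms μ_d(j) / d!.
  record IsSubgraphCentrality (j : Fin n) (C : ℝ) : Set where
    field
      value   : ℕ → ℚ
      μ≈value : ∀ d → μ d j ≈ const (value d)
      sums    : (λ d → value d ℚ.* 1/ d !) SumsTo C

Arc : ℕ → Set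
Arc n = Fin n × Fin n

_≟ᴬ_ : ∀ {n} → DecidableEquality (Arc n)
_≟ᴬ_ = ≡-dec _≟ᶠ_ _≟ᶠ_

-- A multi-digraph without isolated vertices is given by its list of arcs;
-- an arc occurs in the list as often as its multiplicity.
MultiDigraph : ℕ → Set
MultiDigraph n = List (Arc n)

module _ {n : ℕ} (D : MultiDigraph n) where

  ω : Arc n → ℕ
  ω a = length (filter (a ≟ᴬ_) D)

  outdegree : Fin n → ℕ
  outdegree u = length (filter (λ a → u ≟ᶠ proj₁ a) D)

  HasVertex : Fin n → Set
  HasVertex j = Any (λ (u , v) → u ≡ j ⊎ v ≡ j) D

  hasVertex? : Decidable HasVertex
  hasVertex? j = any? (λ (u , v) → (u ≟ᶠ j) ⊎-dec (v ≟ᶠ j)) D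

  -- The product may run over all pairs, as ω vanishes on pairs that are not arcs.
  ∏ω! : ℕ
  ∏ω! = product (map (λ a → ω a !) (cartesianProduct (allFin n) (allFin n)))

  -- Likewise, elements of Fin n that are not vertices have outdegree 0.
  ∏outdegree! : ℕ
  ∏outdegree! = product (map (λ u → outdegree u !) (allFin n))

  ∏outdegree!≢0 : NonZero ∏outdegree!
  ∏outdegree!≢0 = product≢0 (All.map⁺ (universal (λ u → outdegree u ℕ.!≢0) (allFin n)))

arcsOfWalk : ∀ {n k} → Vec (Fin n) (suc k) → List (Arc n)
arcsOfWalk (v ∷ [])     = []
arcsOfWalk (u ∷ v ∷ vs) = (u , v) ∷ arcsOfWalk (v ∷ vs)

module _ {n : ℕ} (D : MultiDigraph n) where

  -- A closed walk using each arc ω times has as many steps as D has arcs, and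
  -- its vertex sequence v₀ ⋯ v_L repeats the starting vertex at the end. Pairs
  -- (u , v) that are not arcs of D have ω = 0, so the walk does not use them.
  VertexSequence : Set
  VertexSequence = Vec (Fin n) (suc (length D))

  IsEulerianClosedWalk : VertexSequence → Set
  IsEulerianClosedWalk w = head w ≡ last w × (∀ u v → ω (arcsOfWalk w) (u , v) ≡ ω D (u , v))

  isEulerianClosedWalk? : Decidable IsEulerianClosedWalk
  isEulerianClosedWalk? w =
    (head w ≟ᶠ last w) ×-dec
    (allᶠ? λ u → allᶠ? λ v → ω (arcsOfWalk w) (u , v) ℕ.≟ ω D (u , v))

  Eulerian : Set
  Eulerian = ∃ IsEulerianClosedWalk

  eulerian? : Dec Eulerian
  eulerian? = any-word? isEulerianClosedWalk?

  -- The Eulerian closed walks starting and ending at j, without repetition.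
  eulerianClosedWalksAt : Fin n → List VertexSequence
  eulerianClosedWalksAt j =
    filter (λ w → isEulerianClosedWalk? w ×-dec (head w ≟ᶠ j)) (words n (suc (length D)))

-- Sequences (i₁α₁ , … , i_dα_d), the components i_k not yet being ordered.
Sequence : ℕ → ℕ → ℕ → Set
Sequence n m d = Vec (Fin n × Vec (Fin n) (m ∸ 1)) d

sequences : ∀ n m d → List (Sequence n m d)
sequences n m d = vectors (cartesianProduct (allFin n) (words n (m ∸ 1))) d

multiDigraph : ∀ {n} m {d} → Sequence n m d → MultiDigraph n
multiDigraph m F = concatMap (λ (i , α) → map (i ,_) (toList α)) (toList F)

Ascending : ∀ {n k} → Vec (Fin n) k → Set
Ascending = Linked _≤ᶠ_

ascending? : ∀ {n k} → Decidable (Ascending {n} {k})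
ascending? = linked? _≤ᶠ?_

module _ {n m : ℕ} (H : UniformHypergraph n m) where
  open UniformHypergraph H

  record _∈ℱ⟨_⟩ {d} (F : Sequence n m d) (j : Fin n) : Set where
    constructor mk
    field
      i-ascending : Ascending (Vec.map proj₁ F)
      edges       : Vecᴬ.All (λ (i , α) → Edge (letters (i ∷ α)) × Ascending α) F
      eulerian    : Eulerian (multiDigraph m F)
      hasVertex   : HasVertex (multiDigraph m F) j

  _∈ℱ⟨_⟩? : ∀ {d} (F : Sequence n m d) j → Dec (F ∈ℱ⟨ j ⟩)
  F ∈ℱ⟨ j ⟩? =
    map′ (λ (a , b , c , v) → mk a b c v) (λ (mk a b c v) → a , b , c , v)
      (ascending? (Vec.map proj₁ F) ×-dec
       Vecᴬ.all? (λ (i , α) → edge? (letters (i ∷ α)) ×-dec ascending? α) F ×-dec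
       eulerian? (multiDigraph m F) ×-dec
       hasVertex? (multiDigraph m F) j)

  -- ℱ_d^{(j)}(H), without repetition.
  ℱ : ∀ d → Fin n → List (Sequence n m d)
  ℱ d j = filter (_∈ℱ⟨ j ⟩?) (sequences n m d)

  b : ∀ {d} → Sequence n m d → ℕ
  b F = ∏ω! (multiDigraph m F)

  c : ∀ {d} → Sequence n m d → ℕ
  c F = ∏outdegree! (multiDigraph m F)

  ∣W⟨_,_⟩∣ : ∀ {d} → Sequence n m d → Fin n → ℕ
  ∣W⟨ F , j ⟩∣ = length (eulerianClosedWalksAt (multiDigraph m F) j)

  _b/c : ∀ {d} → Sequence n m d → ℚ
  F b/c = (+ b F / c F) {{∏outdegree!≢0 (multiDigraph m F)}}

  walkSum : ℕ → Fin n → ℚ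
  walkSum d j = fromℕ ((m ∸ 1) ^ (n ∸ 1)) ℚ.*
    sumℚ (map (λ F → F b/c ℚ.* fromℕ ∣W⟨ F , j ⟩∣) (ℱ d j))

  -- The right-hand sides for d = 0 and d ≥ 1 as one sequence.
  closedForm : ℕ → Fin n → ℚ
  closedForm zero    j = fromℕ ((m ∸ 1) ^ (n ∸ 1))
  closedForm (suc d) j = walkSum (suc d) j

{-# OPTIONS --safe #-}

-- Multiplying the coefficient of a polynomial at a monomial e by e ! turns every
-- partial derivative into a shift of e, so the differential operator attached to
-- F evaluates (A ^ L) j j at the monomial of D(F): it gives ∏ ω ! times the number
-- of closed walks at j with that arc multiset, and, as degrees agree, nothing at
-- any other monomial. The (m − 1) ! rearrangements of an edge word cancel the entry
-- 1 / (m − 1) ! of the adjacency tensor and leave the ascending word, and a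
-- composition (d₁ , … , dₙ) is the same as an ascending sequence of indices.
--
-- The series converges because b(F) ≤ c(F), and the numbers of sequences F and of
-- walks are exponential in d, so the terms are bounded by M K ^ d / d !, hence by
-- a multiple of 2 ^ (− d).
module Submission where

open import Defs
open import Algebra.Core using (Op₂)
open import Algebra.Structures using (IsCommutativeSemiring; module IsCommutativeRing)
open import Data.Bool.Base using (if_then_else_; true; false)
open import Data.Fin.Base using (Fin; zero; suc) renaming (_≤_ to _≤ᶠ_)
open import Data.Fin.Properties using () renaming (_≟_ to _≟ᶠ_; all? to allᶠ?; ≤-antisym to ≤ᶠ-antisym)
open import Data.Fin.Subset using (⁅_⁆; ∣_∣; _∪_; inside; outside) renaming (_∈_ to _∈ˢ_)
import Data.Fin.Subset.Properties as Subset
open import Data.Integer.Base as ℤ using ()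
import Data.Integer.Properties as ℤ
open import Data.List.Base using (List; []; _∷_; [_]; _++_; map; concat; concatMap;
  cartesianProduct; cartesianProductWith; filter; foldr; length; replicate; allFin; tabulate; upTo)
open import Data.List.Membership.Propositional using (_∈_)
open import Data.List.Membership.Propositional.Properties using (∈-allFin; ∈-filter⁺; ∈-filter⁻;
  ∈-cartesianProduct⁺; ∈-cartesianProductWith⁺; ∈-upTo⁺)
open import Data.List.Properties using (filter-++; filter-all; filter-none; filter-some; foldr-++;
  length-++; length-filter; length-map; length-replicate; length-tabulate; map-cong)
open import Data.List.Relation.Unary.All as All using (All; []; _∷_)
import Data.List.Relation.Unary.All.Properties as All
open import Data.List.Relation.Unary.AllPairs using (AllPairs; []; _∷_)
import Data.List.Relation.Unary.AllPairs.Properties as AllPairs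
open import Data.List.Relation.Unary.Any as Any using (here; there; any?)
open import Data.List.Relation.Unary.Unique.Propositional using (Unique)
import Data.List.Relation.Unary.Unique.Propositional.Properties as Unique
open import Data.Nat.Base as ℕ using (ℕ; zero; suc; _≤_; _<_; _!; _∸_; _^_; s≤s; z≤n; NonZero)
open import Data.Nat.GeneralisedArithmetic using (fold)
open import Data.Nat.ListAction using (product)
open import Data.Nat.ListAction.Properties using (product≢0)
import Data.Nat.Properties as ℕ
open import Data.Product.Base using (_×_; _,_; ∃-syntax; proj₁; proj₂)
open import Data.Rational.Base as ℚ using (ℚ; 0ℚ; 1ℚ; _*_; _+_; _/_; fromℚᵘ)
import Data.Rational.Properties as ℚ
open import Data.Rational.Solver using (module +-*-Solver)
open import Data.Rational.Unnormalised.Base as ℚᵘ using (mkℚᵘ; *≡*)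
import Data.Rational.Unnormalised.Properties as ℚᵘ
open import Data.Sum.Base using (inj₁; inj₂)
open import Data.Vec.Base as Vec using (Vec; []; _∷_; toList; lookup)
import Data.Vec.Properties as Vec
open import Data.Vec.Relation.Unary.All as Vecᴬ using ()
open import Data.Vec.Relation.Unary.Linked using ([]; [-]; _∷_)
open import Function.Base using (_∘_; id)
open import Level using (0ℓ)
open import Relation.Binary.Definitions using (DecidableEquality)
open import Relation.Binary.PropositionalEquality hiding ([_])
open import Relation.Nullary using (¬_; Dec; does; yes; no; contradiction; _because_)
open import Relation.Nullary.Decidable using (_×-dec_; dec-true; dec-false)
open import Relation.Unary using (Pred; Decidable)
open ≡-Reasoning

-- Finite sums

-- Reindexing is carried out on sums of 0/1 indicators rather than by bijections: an indicator met
-- by exactly one index is inserted, the sums are swapped, and the inner sum collapses. Since μ_d(j)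
-- must be shown to be constant, the exponent e stays arbitrary throughout. Walks have d(m - 1)
-- steps and D(F) has d(m - 1) arcs, so a match with e times the monomial of D(F) leaves no degree
-- for e. The denominator c(F) comes from the factors 1/(dᵢ(m - 1))!: an index i that occurs dᵢ
-- times in F emits m - 1 arcs each time. The operator side knows nothing of the requirements that
-- D(F) is Eulerian and contains j; for d ≥ 1 they only remove terms without walks. For d = 0 the
-- empty digraph has a closed walk at j without containing j, hence the separate value. A majorant B
-- / 2^k puts the partial sums into nested intervals of length 2B / 2^k, which yields the Cauchy
-- condition with an explicit index.

module Summation {R : Set} {_+_ _*_ : Op₂ R} {0# 1# : R}
                 (isCSR : IsCommutativeSemiring _≡_ _+_ _*_ 0# 1#) where
  open IsCommutativeSemiring isCSR hiding (refl; sym; trans)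

  ∑ : {A : Set} → List A → (A → R) → R
  ∑ xs f = foldr _+_ 0# (map f xs)

  𝟙 : {P : Set} → Dec P → R
  𝟙 P? = if does P? then 1# else 0#

  𝟙-yes : ∀ {P : Set} (P? : Dec P) → P → 𝟙 P? ≡ 1#
  𝟙-yes P? p rewrite dec-true P? p = refl

  𝟙-no : ∀ {P : Set} (P? : Dec P) → ¬ P → 𝟙 P? ≡ 0#
  𝟙-no P? ¬p rewrite dec-false P? ¬p = refl

  𝟙-⇔ : ∀ {P Q : Set} (P? : Dec P) (Q? : Dec Q) → (P → Q) → (Q → P) → 𝟙 P? ≡ 𝟙 Q?
  𝟙-⇔ (yes p) Q? P⇒Q _   = sym (𝟙-yes Q? (P⇒Q p))
  𝟙-⇔ (no ¬p) Q? _   Q⇒P = sym (𝟙-no Q? (¬p ∘ Q⇒P))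

  𝟙-× : ∀ {P Q : Set} (P? : Dec P) (Q? : Dec Q) → 𝟙 (P? ×-dec Q?) ≡ 𝟙 P? * 𝟙 Q?
  𝟙-× (true  because _) Q? = sym (*-identityˡ (𝟙 Q?))
  𝟙-× (false because _) Q? = sym (zeroˡ (𝟙 Q?))

  -- Allows an equation that holds only under `P` to be used behind the indicator of `P`.
  𝟙-cong : ∀ {P : Set} (P? : Dec P) {x y} → (P → x ≡ y) → 𝟙 P? * x ≡ 𝟙 P? * y
  𝟙-cong (yes p) {x} {y} eq = cong (1# *_) (eq p)
  𝟙-cong (no _)  {x} {y} _  = trans (zeroˡ x) (sym (zeroˡ y))

  *-leftSwap : ∀ x y z → x * (y * z) ≡ y * (x * z)
  *-leftSwap x y z = begin
    x * (y * z) ≡⟨ *-assoc x y z ⟨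
    (x * y) * z ≡⟨ cong (_* z) (*-comm x y) ⟩
    (y * x) * z ≡⟨ *-assoc y x z ⟩
    y * (x * z) ∎

  module _ {A : Set} where

    ∑-cong-∈ : ∀ (xs : List A) {f g : A → R} → (∀ {x} → x ∈ xs → f x ≡ g x) → ∑ xs f ≡ ∑ xs g
    ∑-cong-∈ []       f≗g = refl
    ∑-cong-∈ (x ∷ xs) f≗g = cong₂ _+_ (f≗g (here refl)) (∑-cong-∈ xs (f≗g ∘ there))

    ∑-cong : ∀ (xs : List A) {f g : A → R} → (∀ x → f x ≡ g x) → ∑ xs f ≡ ∑ xs g
    ∑-cong xs f≗g = ∑-cong-∈ xs λ {x} _ → f≗g x

    ∑-++ : ∀ xs ys (f : A → R) → ∑ (xs ++ ys) f ≡ ∑ xs f + ∑ ys f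
    ∑-++ []       ys f = sym (+-identityˡ _)
    ∑-++ (x ∷ xs) ys f = begin
      f x + ∑ (xs ++ ys) f      ≡⟨ cong (f x +_) (∑-++ xs ys f) ⟩
      f x + (∑ xs f + ∑ ys f)   ≡⟨ +-assoc (f x) _ _ ⟨
      (f x + ∑ xs f) + ∑ ys f   ∎

    ∑-zero : ∀ (xs : List A) {f : A → R} → (∀ x → f x ≡ 0#) → ∑ xs f ≡ 0#
    ∑-zero []       f≡0 = refl
    ∑-zero (x ∷ xs) f≡0 = trans (cong₂ _+_ (f≡0 x) (∑-zero xs f≡0)) (+-identityˡ 0#)

    ∑-+ : ∀ (xs : List A) (f g : A → R) → ∑ xs (λ x → f x + g x) ≡ ∑ xs f + ∑ xs g
    ∑-+ []       f g = sym (+-identityˡ 0#)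
    ∑-+ (x ∷ xs) f g = begin
      (f x + g x) + ∑ xs (λ x → f x + g x) ≡⟨ cong ((f x + g x) +_) (∑-+ xs f g) ⟩
      (f x + g x) + (∑ xs f + ∑ xs g)      ≡⟨ +-assoc (f x) (g x) _ ⟩
      f x + (g x + (∑ xs f + ∑ xs g))      ≡⟨ cong (f x +_) (sym (+-assoc (g x) _ _)) ⟩
      f x + ((g x + ∑ xs f) + ∑ xs g)      ≡⟨ cong (λ y → f x + (y + ∑ xs g)) (+-comm (g x) _) ⟩
      f x + ((∑ xs f + g x) + ∑ xs g)      ≡⟨ cong (f x +_) (+-assoc _ (g x) _) ⟩
      f x + (∑ xs f + (g x + ∑ xs g))      ≡⟨ +-assoc (f x) _ _ ⟨
      (f x + ∑ xs f) + (g x + ∑ xs g)      ∎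

    *-distribˡ-∑ : ∀ c (xs : List A) (f : A → R) → c * ∑ xs f ≡ ∑ xs (λ x → c * f x)
    *-distribˡ-∑ c []       f = zeroʳ c
    *-distribˡ-∑ c (x ∷ xs) f = trans (distribˡ c (f x) _) (cong ((c * f x) +_) (*-distribˡ-∑ c xs f))

    *-distribʳ-∑ : ∀ c (xs : List A) (f : A → R) → ∑ xs f * c ≡ ∑ xs (λ x → f x * c)
    *-distribʳ-∑ c xs f = begin
      ∑ xs f * c            ≡⟨ *-comm _ c ⟩
      c * ∑ xs f            ≡⟨ *-distribˡ-∑ c xs f ⟩
      ∑ xs (λ x → c * f x)  ≡⟨ ∑-cong xs (λ x → *-comm c (f x)) ⟩
      ∑ xs (λ x → f x * c)  ∎

    ∑-filter : ∀ {P : Pred A 0ℓ} (P? : Decidable P) xs (f : A → R) →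
               ∑ (filter P? xs) f ≡ ∑ xs (λ x → 𝟙 (P? x) * f x)
    ∑-filter P? []       f = refl
    ∑-filter P? (x ∷ xs) f with does (P? x)
    ... | true  = cong₂ _+_ (sym (*-identityˡ (f x))) (∑-filter P? xs f)
    ... | false = begin
      ∑ (filter P? xs) f                              ≡⟨ ∑-filter P? xs f ⟩
      ∑ xs (λ x → 𝟙 (P? x) * f x)                     ≡⟨ +-identityˡ _ ⟨
      0# + ∑ xs (λ x → 𝟙 (P? x) * f x)                ≡⟨ cong (_+ ∑ xs (λ x → 𝟙 (P? x) * f x)) (zeroˡ (f x)) ⟨
      (0# * f x) + ∑ xs (λ x → 𝟙 (P? x) * f x)        ∎

    ∑-𝟙-none : ∀ {P : Pred A 0ℓ} (P? : Decidable P) xs (f : A → R) →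
               (∀ {x} → x ∈ xs → ¬ P x) → ∑ xs (λ x → 𝟙 (P? x) * f x) ≡ 0#
    ∑-𝟙-none P? xs f ¬P = begin
      ∑ xs (λ x → 𝟙 (P? x) * f x)
        ≡⟨ ∑-cong-∈ xs (λ {x} x∈ → trans (cong (_* f x) (𝟙-no (P? x) (¬P x∈))) (zeroˡ (f x))) ⟩
      ∑ xs (λ _ → 0#)  ≡⟨ ∑-zero xs (λ _ → refl) ⟩
      0#               ∎

    -- The collapse that takes the place of a bijection. `Unique` prevents the single solution from
    -- being counted more than once.
    ∑-𝟙-unique : ∀ {P : Pred A 0ℓ} (P? : Decidable P) {xs a} (f : A → R) → Unique xs → a ∈ xs →
                 P a → (∀ {x} → P x → x ≡ a) → ∑ xs (λ x → 𝟙 (P? x) * f x) ≡ f a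
    ∑-𝟙-unique P? {x ∷ xs} f (x∉ ∷ _) (here refl) Pa P⇒≡ = begin
      (𝟙 (P? x) * f x) + ∑ xs (λ x → 𝟙 (P? x) * f x)
        ≡⟨ cong₂ _+_ (trans (cong (_* f x) (𝟙-yes (P? x) Pa)) (*-identityˡ (f x)))
                     (∑-𝟙-none P? xs f (λ y∈ Py → All.lookup x∉ y∈ (sym (P⇒≡ Py)))) ⟩
      f x + 0#  ≡⟨ +-identityʳ (f x) ⟩
      f x       ∎
    ∑-𝟙-unique P? {x ∷ xs} {a} f (x∉ ∷ uniq) (there a∈) Pa P⇒≡ = begin
      (𝟙 (P? x) * f x) + ∑ xs (λ x → 𝟙 (P? x) * f x)
        ≡⟨ cong₂ _+_ (trans (cong (_* f x) (𝟙-no (P? x) (λ Px → All.lookup x∉ a∈ (P⇒≡ Px))))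
                            (zeroˡ (f x)))
                     (∑-𝟙-unique P? f uniq a∈ Pa P⇒≡) ⟩
      0# + f a  ≡⟨ +-identityˡ (f a) ⟩
      f a       ∎

  module _ {A B : Set} where

    ∑-map : ∀ (h : A → B) xs (f : B → R) → ∑ (map h xs) f ≡ ∑ xs (f ∘ h)
    ∑-map h []       f = refl
    ∑-map h (x ∷ xs) f = cong (f (h x) +_) (∑-map h xs f)

    ∑-concat-map : ∀ (h : A → List B) xs (f : B → R) →
                   ∑ (concat (map h xs)) f ≡ ∑ xs (λ x → ∑ (h x) f)
    ∑-concat-map h []       f = refl
    ∑-concat-map h (x ∷ xs) f =
      trans (∑-++ (h x) _ f) (cong (∑ (h x) f +_) (∑-concat-map h xs f))

    ∑-swap : ∀ (xs : List A) (ys : List B) (f : A → B → R) →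
             ∑ xs (λ x → ∑ ys (f x)) ≡ ∑ ys (λ y → ∑ xs (λ x → f x y))
    ∑-swap []       ys f = sym (∑-zero ys (λ _ → refl))
    ∑-swap (x ∷ xs) ys f = begin
      ∑ ys (f x) + ∑ xs (λ x → ∑ ys (f x))               ≡⟨ cong (∑ ys (f x) +_) (∑-swap xs ys f) ⟩
      ∑ ys (f x) + ∑ ys (λ y → ∑ xs (λ x → f x y))       ≡⟨ ∑-+ ys (f x) _ ⟨
      ∑ ys (λ y → f x y + ∑ xs (λ x → f x y))            ∎

  ∑-cartesianProductWith : ∀ {A B C : Set} (h : A → B → C) xs ys (f : C → R) →
    ∑ (cartesianProductWith h xs ys) f ≡ ∑ xs (λ x → ∑ ys (λ y → f (h x y)))
  ∑-cartesianProductWith h []       ys f = refl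
  ∑-cartesianProductWith h (x ∷ xs) ys f =
    trans (∑-++ (map (h x) ys) _ f)
          (cong₂ _+_ (∑-map (h x) ys f) (∑-cartesianProductWith h xs ys f))

-- Words and walks are counted in ℕ and weighted in ℚ; `fromℕ-∑-𝟙` carries a count from one to the
-- other.
module ℕ∑ = Summation ℕ.+-*-isCommutativeSemiring
module ℚ∑ = Summation (IsCommutativeRing.isCommutativeSemiring ℚ.+-*-isCommutativeRing)

-- Words and their rearrangements

∷-injective : ∀ {A : Set} {k} {x y : A} {v w : Vec A k} → x ∷ v ≡ y ∷ w → x ≡ y × v ≡ w
∷-injective refl = refl , refl

vectors-unique : ∀ {A : Set} {xs : List A} k → Unique xs → Unique (vectors xs k)
vectors-unique zero    uniq = [] ∷ []
vectors-unique (suc k) uniq =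
  Unique.cartesianProductWith⁺ _∷_ ∷-injective uniq (vectors-unique k uniq)

length-cartesianProductWith : ∀ {A B C : Set} (f : A → B → C) xs ys →
  length (cartesianProductWith f xs ys) ≡ length xs ℕ.* length ys
length-cartesianProductWith f []       ys = refl
length-cartesianProductWith f (x ∷ xs) ys =
  trans (length-++ (map (f x) ys))
        (cong₂ ℕ._+_ (length-map (f x) ys) (length-cartesianProductWith f xs ys))

length-vectors : ∀ {A : Set} (xs : List A) k → length (vectors xs k) ≡ length xs ^ k
length-vectors xs zero    = refl
length-vectors xs (suc k) =
  trans (length-cartesianProductWith _∷_ xs (vectors xs k))
        (cong (length xs ℕ.*_) (length-vectors xs k))

length-filter≡∑ : ∀ {A : Set} {P : Pred A 0ℓ} (P? : Decidable P) xs →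
                  length (filter P? xs) ≡ ℕ∑.∑ xs (λ x → ℕ∑.𝟙 (P? x))
length-filter≡∑ P? []       = refl
length-filter≡∑ P? (x ∷ xs) with does (P? x)
... | true  = cong suc (length-filter≡∑ P? xs)
... | false = length-filter≡∑ P? xs

module Counting {A : Set} (_≟_ : DecidableEquality A) where

  -- Built from the same `filter` as `ω`, so that for `_≟ᴬ_` it is `ω` by definition and the lemmas
  -- below speak of arc multiplicities.
  count : A → List A → ℕ
  count a xs = length (filter (a ≟_) xs)

  count-++ : ∀ a xs ys → count a (xs ++ ys) ≡ count a xs ℕ.+ count a ys
  count-++ a xs ys = trans (cong length (filter-++ (a ≟_) xs ys)) (length-++ (filter (a ≟_) xs))

  count-∷ : ∀ a x xs → count a (x ∷ xs) ≡ ℕ∑.𝟙 (a ≟ x) ℕ.+ count a xs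
  count-∷ a x xs with does (a ≟ x)
  ... | true  = refl
  ... | false = refl

  count-∷-≡ : ∀ a xs → count a (a ∷ xs) ≡ suc (count a xs)
  count-∷-≡ a xs = trans (count-∷ a a xs) (cong (ℕ._+ count a xs) (ℕ∑.𝟙-yes (a ≟ a) refl))

  count-∷-≢ : ∀ {a x} xs → a ≢ x → count a (x ∷ xs) ≡ count a xs
  count-∷-≢ {a} {x} xs a≢x = trans (count-∷ a x xs) (cong (ℕ._+ count a xs) (ℕ∑.𝟙-no (a ≟ x) a≢x))

  ∈⇒count>0 : ∀ {a xs} → a ∈ xs → 0 < count a xs
  ∈⇒count>0 {a} a∈ = filter-some (a ≟_) a∈

  count>0⇒∈ : ∀ {a} xs → 0 < count a xs → a ∈ xs
  count>0⇒∈ {a} (x ∷ xs) c>0 with a ≟ x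
  ... | yes a≡x = here a≡x
  ... | no  _   = there (count>0⇒∈ xs c>0)

  ∑-count : ∀ {univ} → Unique univ → (∀ a → a ∈ univ) →
            ∀ xs → ℕ∑.∑ univ (λ a → count a xs) ≡ length xs
  ∑-count {univ} uniq all∈ []       = ℕ∑.∑-zero univ (λ _ → refl)
  ∑-count {univ} uniq all∈ (x ∷ xs) = begin
    ℕ∑.∑ univ (λ a → count a (x ∷ xs))
      ≡⟨ ℕ∑.∑-cong univ (λ a → count-∷ a x xs) ⟩
    ℕ∑.∑ univ (λ a → ℕ∑.𝟙 (a ≟ x) ℕ.+ count a xs)
      ≡⟨ ℕ∑.∑-+ univ _ _ ⟩
    ℕ∑.∑ univ (λ a → ℕ∑.𝟙 (a ≟ x)) ℕ.+ ℕ∑.∑ univ (λ a → count a xs)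
      ≡⟨ cong₂ ℕ._+_ (trans (ℕ∑.∑-cong univ (λ a → sym (ℕ.*-identityʳ _)))
                          (ℕ∑.∑-𝟙-unique (_≟ x) (λ _ → 1) uniq (all∈ x) refl id))
                   (∑-count uniq all∈ xs) ⟩
    suc (length xs) ∎

  count-replicate : ∀ a x k → count a (replicate k x) ≡ ℕ∑.𝟙 (x ≟ a) ℕ.* k
  count-replicate a x k with a ≟ x
  ... | yes refl = begin
    length (filter (a ≟_) (replicate k a))
      ≡⟨ cong length (filter-all (a ≟_) (All.replicate⁺ k refl)) ⟩
    length (replicate k a)  ≡⟨ length-replicate k ⟩
    k                       ≡⟨ ℕ.*-identityˡ k ⟨
    1 ℕ.* k                   ≡⟨ cong (ℕ._* k) (ℕ∑.𝟙-yes (a ≟ a) refl) ⟨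
    ℕ∑.𝟙 (a ≟ a) ℕ.* k        ∎
  ... | no a≢x = trans (cong length (filter-none (a ≟_) (All.replicate⁺ k a≢x)))
                       (cong (ℕ._* k) (sym (ℕ∑.𝟙-no (x ≟ a) (a≢x ∘ sym))))

  -- Also the list of indices, outermost first, in which the nested folds of a summand of `μ` apply
  -- the tensor derivatives. Working with this exact list avoids any commutation of derivatives.
  blocks : List A → (A → ℕ) → List A
  blocks xs c = concatMap (λ x → replicate (c x) x) xs

  count-blocks : ∀ {univ} → Unique univ → (∀ a → a ∈ univ) → ∀ c a → count a (blocks univ c) ≡ c a
  count-blocks {univ} uniq all∈ c a = begin
    count a (blocks univ c)
      ≡⟨ count≡∑ (blocks univ c) ⟩
    ℕ∑.∑ (blocks univ c) (λ x → ℕ∑.𝟙 (a ≟ x))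
      ≡⟨ ℕ∑.∑-concat-map (λ x → replicate (c x) x) univ _ ⟩
    ℕ∑.∑ univ (λ x → ℕ∑.∑ (replicate (c x) x) (λ y → ℕ∑.𝟙 (a ≟ y)))
      ≡⟨ ℕ∑.∑-cong univ (λ x → trans (sym (count≡∑ (replicate (c x) x))) (count-replicate a x (c x))) ⟩
    ℕ∑.∑ univ (λ x → ℕ∑.𝟙 (x ≟ a) ℕ.* c x)
      ≡⟨ ℕ∑.∑-𝟙-unique (_≟ a) c uniq (all∈ a) refl id ⟩
    c a ∎
    where
    count≡∑ : ∀ xs → count a xs ≡ ℕ∑.∑ xs (λ x → ℕ∑.𝟙 (a ≟ x))
    count≡∑ = length-filter≡∑ (a ≟_)

  length-blocks : ∀ xs c → length (blocks xs c) ≡ ℕ∑.∑ xs c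
  length-blocks []       c = refl
  length-blocks (x ∷ xs) c =
    trans (length-++ (replicate (c x) x)) (cong₂ ℕ._+_ (length-replicate (c x)) (length-blocks xs c))

  extract : ∀ {k a} (v : Vec A (suc k)) → a ∈ toList v →
            ∃[ w ] (∀ b → count b (toList v) ≡ count b (a ∷ toList {n = k} w))
  extract {k} (x ∷ v) (here refl) = v , λ b → refl
  extract {zero}  (x ∷ []) (there ())
  extract {suc k} {a} (x ∷ v) (there a∈) with extract v a∈
  ... | w , same = x ∷ w , λ b → begin
    count b (x ∷ toList v)
      ≡⟨ count-∷ b x _ ⟩
    ℕ∑.𝟙 (b ≟ x) ℕ.+ count b (toList v)
      ≡⟨ cong (ℕ∑.𝟙 (b ≟ x) ℕ.+_) (trans (same b) (count-∷ b a _)) ⟩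
    ℕ∑.𝟙 (b ≟ x) ℕ.+ (ℕ∑.𝟙 (b ≟ a) ℕ.+ count b (toList w))
      ≡⟨ ℕ.+-assoc (ℕ∑.𝟙 (b ≟ x)) _ _ ⟨
    (ℕ∑.𝟙 (b ≟ x) ℕ.+ ℕ∑.𝟙 (b ≟ a)) ℕ.+ count b (toList w)
      ≡⟨ cong (ℕ._+ count b (toList w)) (ℕ.+-comm (ℕ∑.𝟙 (b ≟ x)) _) ⟩
    (ℕ∑.𝟙 (b ≟ a) ℕ.+ ℕ∑.𝟙 (b ≟ x)) ℕ.+ count b (toList w)
      ≡⟨ ℕ.+-assoc (ℕ∑.𝟙 (b ≟ a)) _ _ ⟩
    ℕ∑.𝟙 (b ≟ a) ℕ.+ (ℕ∑.𝟙 (b ≟ x) ℕ.+ count b (toList w))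
      ≡⟨ cong (ℕ∑.𝟙 (b ≟ a) ℕ.+_) (count-∷ b x _) ⟨
    ℕ∑.𝟙 (b ≟ a) ℕ.+ count b (x ∷ toList w)
      ≡⟨ count-∷ b a _ ⟨
    count b (a ∷ x ∷ toList w) ∎

  count-∷-cancel : ∀ x {xs ys} → (∀ a → count a (x ∷ xs) ≡ count a (x ∷ ys)) →
                   ∀ a → count a xs ≡ count a ys
  count-∷-cancel x {xs} {ys} same a = ℕ.+-cancelˡ-≡ (ℕ∑.𝟙 (a ≟ x)) _ _
    (trans (sym (count-∷ a x xs)) (trans (same a) (count-∷ a x ys)))

open module Letters {n} = Counting (_≟ᶠ_ {n}) public

ascending-head : ∀ {n k} {x : Fin n} {v : Vec (Fin n) k} → Ascending (x ∷ v) →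
                 ∀ {y} → y ∈ toList (x ∷ v) → x ≤ᶠ y
ascending-head _ (here refl) = ℕ.≤-refl
ascending-head {v = y ∷ v} (x≤y ∷ asc) (there y∈) = ℕ.≤-trans x≤y (ascending-head asc y∈)

ascending-tail : ∀ {n k} {x : Fin n} {v : Vec (Fin n) k} → Ascending (x ∷ v) → Ascending v
ascending-tail [-]       = []
ascending-tail (_ ∷ asc) = asc

-- Each head is the least letter of the common multiset, so each bounds the other; cancelling it
-- leaves the same situation for the tails.
ascending-unique : ∀ {n k} {v w : Vec (Fin n) k} → Ascending v → Ascending w →
                   (∀ a → count a (toList v) ≡ count a (toList w)) → v ≡ w
ascending-unique {v = []} {[]} _ _ _ = refl
ascending-unique {v = x ∷ v} {y ∷ w} ascv ascw same = go x≡y same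
  where
  x≡y : x ≡ y
  x≡y = ≤ᶠ-antisym
    (ascending-head ascv (count>0⇒∈ (x ∷ toList v) (subst (0 <_) (sym (same y)) (∈⇒count>0 {xs = y ∷ toList w} (here refl)))))
    (ascending-head ascw (count>0⇒∈ (y ∷ toList w) (subst (0 <_) (same x) (∈⇒count>0 {xs = x ∷ toList v} (here refl)))))
  go : ∀ {z} → x ≡ z → (∀ a → count a (x ∷ toList v) ≡ count a (z ∷ toList w)) → x ∷ v ≡ z ∷ w
  go refl same = cong (x ∷_)
    (ascending-unique (ascending-tail ascv) (ascending-tail ascw) (count-∷-cancel x same))

toList-surjective : ∀ {A : Set} {k} (xs : List A) → length xs ≡ k → ∃[ v ] toList {n = k} v ≡ xs
toList-surjective []       refl = [] , refl
toList-surjective (x ∷ xs) refl with toList-surjective xs refl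
... | v , eq = x ∷ v , cong (x ∷_) eq

-- `AllPairs` is the form of ascendance that passes through the concatenations in `blocks`;
-- `Ascending` only compares neighbours.
allPairs⇒ascending : ∀ {n k} (v : Vec (Fin n) k) → AllPairs _≤ᶠ_ (toList v) → Ascending v
allPairs⇒ascending []          _                 = []
allPairs⇒ascending (x ∷ [])    _                 = [-]
allPairs⇒ascending (x ∷ y ∷ v) ((x≤y ∷ _) ∷ ps) = x≤y ∷ allPairs⇒ascending (y ∷ v) ps

blocks-ascending : ∀ {n} (xs : List (Fin n)) c → AllPairs _≤ᶠ_ xs → AllPairs _≤ᶠ_ (blocks xs c)
blocks-ascending []       c _           = []
blocks-ascending (x ∷ xs) c (x≤ ∷ ps) =
  AllPairs.++⁺ (replicate-ascending (c x)) (blocks-ascending xs c ps)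
    (All.replicate⁺ (c x) (All.concat⁺ (All.map⁺ (All.map (λ x≤y → All.replicate⁺ (c _) x≤y) x≤))))
  where
  replicate-ascending : ∀ k → AllPairs _≤ᶠ_ (replicate k x)
  replicate-ascending zero    = []
  replicate-ascending (suc k) = All.replicate⁺ k ℕ.≤-refl ∷ replicate-ascending k

-- Counting sort from prescribed multiplicities. The underlying list is returned as well, because
-- the exchange of compositions for index words needs it to be `blocks` itself.
sort : ∀ {n k} (c : Fin n → ℕ) → ℕ∑.∑ (allFin n) c ≡ k →
       ∃[ v ] (toList {n = k} v ≡ blocks (allFin n) c × Ascending v ×
               (∀ a → count a (toList v) ≡ c a))
sort {n} c refl with toList-surjective (blocks (allFin n) c) (length-blocks (allFin n) c)
... | v , eq = v , eq ,
  allPairs⇒ascending v (subst (AllPairs _≤ᶠ_) (sym eq)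
    (blocks-ascending (allFin n) c (AllPairs.tabulate⁺-< ℕ.<⇒≤))) ,
  λ a → trans (cong (count a) eq) (count-blocks (Unique.allFin⁺ n) ∈-allFin c a)

infix 4 _∼_ _∼?_
-- Rearrangement of words, encoded by equal letter counts: decidable over a finite alphabet, with no
-- permutation to carry along.
_∼_ : ∀ {n k} → Vec (Fin n) k → Vec (Fin n) k → Set
v ∼ w = ∀ a → count a (toList v) ≡ count a (toList w)

_∼?_ : ∀ {n k} (v w : Vec (Fin n) k) → Dec (v ∼ w)
v ∼? w = allᶠ? λ a → count a (toList v) ℕ.≟ count a (toList w)

-- Split by the first letter a of the rearrangement. If a does not occur in `w` there is none; if it
-- does, it occurs once, and the rest rearranges `w` with a removed. The counts of all letters add
-- up to the length, giving suc k times k !.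
∑-rearrangements : ∀ {n k} (w : Vec (Fin n) k) → (∀ a → count a (toList w) ≤ 1) →
                   ℕ∑.∑ (words n k) (λ v → ℕ∑.𝟙 (v ∼? w)) ≡ k !
∑-rearrangements {n} {zero}  []  _ = cong (ℕ._+ 0) (ℕ∑.𝟙-yes (_∼?_ {n} [] []) (λ _ → refl))
∑-rearrangements {n} {suc k} w dist = begin
  ℕ∑.∑ (words n (suc k)) (λ v → ℕ∑.𝟙 (v ∼? w))
    ≡⟨ ℕ∑.∑-cartesianProductWith _∷_ (allFin n) (words n k) _ ⟩
  ℕ∑.∑ (allFin n) (λ a → ℕ∑.∑ (words n k) (λ v → ℕ∑.𝟙 (a ∷ v ∼? w)))
    ≡⟨ ℕ∑.∑-cong (allFin n) perLetter ⟩
  ℕ∑.∑ (allFin n) (λ a → count a (toList w) ℕ.* k !)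
    ≡⟨ ℕ∑.*-distribʳ-∑ (k !) (allFin n) _ ⟨
  ℕ∑.∑ (allFin n) (λ a → count a (toList w)) ℕ.* k !
    ≡⟨ cong (ℕ._* k !) (trans (∑-count (Unique.allFin⁺ n) ∈-allFin (toList w)) (Vec.length-toList w)) ⟩
  suc k ! ∎
  where
  perLetter : ∀ a → ℕ∑.∑ (words n k) (λ v → ℕ∑.𝟙 (a ∷ v ∼? w)) ≡ count a (toList w) ℕ.* k !
  perLetter a with any? (a ≟ᶠ_) (toList w)
  ... | no a∉ = trans
    (trans (ℕ∑.∑-cong (words n k) (λ v → ℕ∑.𝟙-no (a ∷ v ∼? w) λ same →
             a∉ (count>0⇒∈ (toList w) (subst (0 <_) (same a) (∈⇒count>0 {xs = a ∷ toList v} (here refl))))))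
           (ℕ∑.∑-zero (words n k) (λ _ → refl)))
    (cong (ℕ._* k !) (sym (cong length (filter-none (a ≟ᶠ_) (All.¬Any⇒All¬ (toList w) a∉)))))
  ... | yes a∈ with extract w a∈
  ... | w′ , same = begin
    ℕ∑.∑ (words n k) (λ v → ℕ∑.𝟙 (a ∷ v ∼? w))
      ≡⟨ ℕ∑.∑-cong (words n k) (λ v → ℕ∑.𝟙-⇔ (a ∷ v ∼? w) (v ∼? w′)
           (λ v∼w → count-∷-cancel a (λ b → trans (v∼w b) (same b)))
           (λ v∼w′ b → trans (count-∷ b a (toList v))
              (trans (cong (ℕ∑.𝟙 (b ≟ᶠ a) ℕ.+_) (v∼w′ b)) (trans (sym (count-∷ b a (toList w′))) (sym (same b)))))) ⟩
    ℕ∑.∑ (words n k) (λ v → ℕ∑.𝟙 (v ∼? w′))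
      ≡⟨ ∑-rearrangements w′ (λ b → ℕ.≤-trans
           (subst (count b (toList w′) ≤_) (sym (count-∷ b a (toList w′))) (ℕ.m≤n+m _ _))
           (subst (_≤ 1) (same b) (dist b))) ⟩
    k !
      ≡⟨ ℕ.*-identityˡ (k !) ⟨
    1 ℕ.* k !
      ≡⟨ cong (ℕ._* k !) (ℕ.≤-antisym (∈⇒count>0 a∈) (dist a)) ⟩
    count a (toList w) ℕ.* k ! ∎

-- Natural numbers as rationals

fromℚᵘ-homo-* : ∀ p q → fromℚᵘ (p ℚᵘ.* q) ≡ fromℚᵘ p * fromℚᵘ q
fromℚᵘ-homo-* p q = ℚ.toℚᵘ-injective (ℚᵘ.≃-trans (ℚ.toℚᵘ-fromℚᵘ (p ℚᵘ.* q))
  (ℚᵘ.≃-sym (ℚᵘ.≃-trans (ℚ.toℚᵘ-homo-* (fromℚᵘ p) (fromℚᵘ q))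
    (ℚᵘ.*-cong (ℚ.toℚᵘ-fromℚᵘ p) (ℚ.toℚᵘ-fromℚᵘ q)))))

fromℚᵘ-homo-+ : ∀ p q → fromℚᵘ (p ℚᵘ.+ q) ≡ fromℚᵘ p + fromℚᵘ q
fromℚᵘ-homo-+ p q = ℚ.toℚᵘ-injective (ℚᵘ.≃-trans (ℚ.toℚᵘ-fromℚᵘ (p ℚᵘ.+ q))
  (ℚᵘ.≃-sym (ℚᵘ.≃-trans (ℚ.toℚᵘ-homo-+ (fromℚᵘ p) (fromℚᵘ q))
    (ℚᵘ.+-cong (ℚ.toℚᵘ-fromℚᵘ p) (ℚ.toℚᵘ-fromℚᵘ q)))))

fromℕ-homo-+ : ∀ a b → fromℕ (a ℕ.+ b) ≡ fromℕ a + fromℕ b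
fromℕ-homo-+ a b = trans
  (ℚ.fromℚᵘ-cong {mkℚᵘ (ℤ.+ (a ℕ.+ b)) 0} {mkℚᵘ (ℤ.+ a) 0 ℚᵘ.+ mkℚᵘ (ℤ.+ b) 0}
    (*≡* (cong (ℤ._* ℤ.+ 1) (sym (cong₂ ℤ._+_ (ℤ.*-identityʳ (ℤ.+ a)) (ℤ.*-identityʳ (ℤ.+ b)))))))
  (fromℚᵘ-homo-+ (mkℚᵘ (ℤ.+ a) 0) (mkℚᵘ (ℤ.+ b) 0))

fromℕ-homo-* : ∀ a b → fromℕ (a ℕ.* b) ≡ fromℕ a * fromℕ b
fromℕ-homo-* a b = trans
  (ℚ.fromℚᵘ-cong {mkℚᵘ (ℤ.+ (a ℕ.* b)) 0} {mkℚᵘ (ℤ.+ a) 0 ℚᵘ.* mkℚᵘ (ℤ.+ b) 0}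
    (*≡* (cong (ℤ._* ℤ.+ 1) (ℤ.pos-* a b))))
  (fromℚᵘ-homo-* (mkℚᵘ (ℤ.+ a) 0) (mkℚᵘ (ℤ.+ b) 0))

/-* : ∀ a c .{{_ : NonZero c}} → (ℤ.+ a / c) * fromℕ c ≡ fromℕ a
/-* a (suc c) = trans (sym (fromℚᵘ-homo-* (mkℚᵘ (ℤ.+ a) c) (mkℚᵘ (ℤ.+ suc c) 0)))
  (ℚ.fromℚᵘ-cong {mkℚᵘ (ℤ.+ a) c ℚᵘ.* mkℚᵘ (ℤ.+ suc c) 0} {mkℚᵘ (ℤ.+ a) 0}
    (*≡* (ℤ.*-assoc (ℤ.+ a) (ℤ.+ suc c) (ℤ.+ 1))))

fromℕ-*-cancelʳ : ∀ c .{{_ : NonZero c}} {p q} → p * fromℕ c ≡ q * fromℕ c → p ≡ q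
fromℕ-*-cancelʳ c {p} {q} eq = begin
  p                          ≡⟨ expand p ⟩
  (p * fromℕ c) * (ℤ.+ 1 / c)  ≡⟨ cong (_* (ℤ.+ 1 / c)) eq ⟩
  (q * fromℕ c) * (ℤ.+ 1 / c)  ≡⟨ expand q ⟨
  q                          ∎
  where
  expand : ∀ r → r ≡ (r * fromℕ c) * (ℤ.+ 1 / c)
  expand r = begin
    r                          ≡⟨ ℚ.*-identityʳ r ⟨
    r * 1ℚ                     ≡⟨ cong (r *_) (trans (ℚ.*-comm (fromℕ c) (ℤ.+ 1 / c)) (/-* 1 c)) ⟨
    r * (fromℕ c * (ℤ.+ 1 / c))  ≡⟨ ℚ.*-assoc r (fromℕ c) (ℤ.+ 1 / c) ⟨
    (r * fromℕ c) * (ℤ.+ 1 / c)  ∎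

fromℕ-≥0 : ∀ a → 0ℚ ℚ.≤ fromℕ a
fromℕ-≥0 a = ℚ.nonNegative⁻¹ (fromℕ a) {{ℚ.normalize-nonNeg a 1}}

fromℕ-mono-≤ : ∀ {a b} → a ≤ b → fromℕ a ℚ.≤ fromℕ b
fromℕ-mono-≤ {a} {b} a≤b = subst₂ ℚ._≤_ (ℚ.+-identityʳ (fromℕ a))
  (trans (sym (fromℕ-homo-+ a (b ∸ a))) (cong fromℕ (ℕ.m+[n∸m]≡n a≤b)))
  (ℚ.+-monoʳ-≤ (fromℕ a) (fromℕ-≥0 (b ∸ a)))

fromℕ-∑-𝟙 : ∀ {A : Set} {P : Pred A 0ℓ} (P? : Decidable P) xs →
            fromℕ (ℕ∑.∑ xs (λ x → ℕ∑.𝟙 (P? x))) ≡ ℚ∑.∑ xs (λ x → ℚ∑.𝟙 (P? x))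
fromℕ-∑-𝟙 P? []       = refl
fromℕ-∑-𝟙 P? (x ∷ xs) = trans (fromℕ-homo-+ (ℕ∑.𝟙 (P? x)) _)
  (cong₂ _+_ (fromℕ-𝟙 (P? x)) (fromℕ-∑-𝟙 P? xs))
  where
  fromℕ-𝟙 : ∀ {P : Set} (P? : Dec P) → fromℕ (ℕ∑.𝟙 P?) ≡ ℚ∑.𝟙 P?
  fromℕ-𝟙 (true  because _) = refl
  fromℕ-𝟙 (false because _) = refl

product-cong : ∀ {A : Set} (xs : List A) {f g : A → ℕ} → (∀ x → f x ≡ g x) →
               product (map f xs) ≡ product (map g xs)
product-cong xs f≗g = cong product (map-cong f≗g xs)

-- Adding one arc changes a single factor in a product of factorials, from k ! to (k + 1) !. This
-- serves exponents, arc multiplicities and outdegrees alike.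
product-update : ∀ {A : Set} {xs : List A} {a} {f g : A → ℕ} k → Unique xs → a ∈ xs →
                 f a ≡ k ℕ.* g a → (∀ x → x ≢ a → f x ≡ g x) →
                 product (map f xs) ≡ k ℕ.* product (map g xs)
product-update {xs = x ∷ xs} {f = f} {g} k (x∉ ∷ _) (here refl) fa f≡g = begin
  f x ℕ.* product (map f xs)
    ≡⟨ cong₂ ℕ._*_ fa (agree xs x∉) ⟩
  (k ℕ.* g x) ℕ.* product (map g xs)
    ≡⟨ ℕ.*-assoc k (g x) _ ⟩
  k ℕ.* (g x ℕ.* product (map g xs)) ∎
  where
  agree : ∀ ys → All (x ≢_) ys → product (map f ys) ≡ product (map g ys)
  agree []       []           = refl
  agree (y ∷ ys) (x≢y ∷ x∉ys) = cong₂ ℕ._*_ (f≡g y (x≢y ∘ sym)) (agree ys x∉ys)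
product-update {xs = x ∷ xs} {a} {f} {g} k (x∉ ∷ uniq) (there a∈) fa f≡g = begin
  f x ℕ.* product (map f xs)
    ≡⟨ cong₂ ℕ._*_ (f≡g x (All.lookup x∉ a∈)) (product-update k uniq a∈ fa f≡g) ⟩
  g x ℕ.* (k ℕ.* product (map g xs))
    ≡⟨ ℕ∑.*-leftSwap (g x) k _ ⟩
  k ℕ.* (g x ℕ.* product (map g xs)) ∎

-- Monomials and derivatives

arcs : ∀ n → List (Arc n)
arcs n = cartesianProduct (allFin n) (allFin n)

arcs-unique : ∀ n → Unique (arcs n)
arcs-unique n = Unique.cartesianProduct⁺ (Unique.allFin⁺ n) (Unique.allFin⁺ n)

∈-arcs : ∀ {n} (a : Arc n) → a ∈ arcs n
∈-arcs (u , v) = ∈-cartesianProduct⁺ (∈-allFin u) (∈-allFin v)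

module Arcs {n} = Counting (_≟ᴬ_ {n})

infix 4 _≗ᴹ_
_≗ᴹ_ : ∀ {n} → Monomial n → Monomial n → Set
e ≗ᴹ f = ∀ i j → e i j ≡ f i j

infix 8 _!ᴹ
-- The multi-index factorial; at `monomial D` it unfolds to `∏ω! D`.
_!ᴹ : ∀ {n} → Monomial n → ℕ
_!ᴹ {n} e = product (map (λ (u , v) → e u v !) (arcs n))

infixl 6 _⊕_
-- An arc (u , v) stands for the variable a u v, so adjoining the arcs of `D` is multiplication by
-- the product of their variables.
_⊕_ : ∀ {n} → Monomial n → MultiDigraph n → Monomial n
(e ⊕ D) u v = e u v ℕ.+ ω D (u , v)

𝟎 : ∀ {n} → Monomial n
𝟎 _ _ = 0

monomial : ∀ {n} → MultiDigraph n → Monomial n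
monomial D = 𝟎 ⊕ D

⊕-++ : ∀ {n} (e : Monomial n) C D → e ⊕ (C ++ D) ≗ᴹ e ⊕ C ⊕ D
⊕-++ e C D u v = trans (cong (e u v ℕ.+_) (Arcs.count-++ (u , v) C D))
  (sym (ℕ.+-assoc (e u v) (ω C (u , v)) (ω D (u , v))))

⊕-congˡ : ∀ {n} {e f : Monomial n} D → e ≗ᴹ f → e ⊕ D ≗ᴹ f ⊕ D
⊕-congˡ D e≗f u v = cong (ℕ._+ ω D (u , v)) (e≗f u v)

!ᴹ-cong : ∀ {n} {e f : Monomial n} → e ≗ᴹ f → e !ᴹ ≡ f !ᴹ
!ᴹ-cong {n} e≗f = product-cong (arcs n) λ (u , v) → cong _! (e≗f u v)

!ᴹ-⊕ : ∀ {n} (e : Monomial n) i j → (e ⊕ [ (i , j) ]) !ᴹ ≡ suc (e i j) ℕ.* e !ᴹ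
!ᴹ-⊕ {n} e i j = product-update (suc (e i j)) (arcs-unique n) (∈-arcs (i , j))
  (cong _! (trans (cong (e i j ℕ.+_) (Arcs.count-∷-≡ (i , j) [])) (ℕ.+-comm (e i j) 1)))
  (λ (u , v) ≢ → cong _! (trans (cong (e u v ℕ.+_) (Arcs.count-∷-≢ [] ≢)) (ℕ.+-identityʳ (e u v))))

varExponent≡ω : ∀ {n} (i j u v : Fin n) → varExponent i j u v ≡ ω [ (i , j) ] (u , v)
varExponent≡ω i j u v = trans
  (ℕ∑.𝟙-⇔ ((i ≟ᶠ u) ×-dec (j ≟ᶠ v)) ((u , v) ≟ᴬ (i , j)) (λ { (refl , refl) → refl }) (λ { refl → refl , refl }))
  (trans (sym (ℕ.+-identityʳ _)) (sym (Arcs.count-∷ (u , v) (i , j) [])))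

-- The linear extension to formal sums of a function on monomials; equal monomials in different
-- terms never have to be collected.
⟨_,_⟩ : ∀ {n} → Polynomial n → (Monomial n → ℚ) → ℚ
⟨ p , g ⟩ = ℚ∑.∑ p (λ (q , f) → q * g f)

-- The functional dual to the divided-power basis: ⟨ p , δ e ⟩ is e ! times the
-- coefficient of p at e. In this normalisation a derivative is a plain shift of e.
δ : ∀ {n} → Monomial n → Monomial n → ℚ
δ e f = ℚ∑.𝟙 (f ≟ᴹ e) * fromℕ (e !ᴹ)

δ-cong : ∀ {n} {e e′ f f′ : Monomial n} → e ≗ᴹ e′ → f ≗ᴹ f′ → δ e f ≡ δ e′ f′
δ-cong {e = e} {e′} {f} {f′} e≗ f≗ = cong₂ _*_
  (ℚ∑.𝟙-⇔ (f ≟ᴹ e) (f′ ≟ᴹ e′)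
    (λ eq i j → trans (sym (f≗ i j)) (trans (eq i j) (e≗ i j)))
    (λ eq i j → trans (f≗ i j) (trans (eq i j) (sym (e≗ i j)))))
  (cong fromℕ (!ᴹ-cong e≗))

-- When the exponent of a i j in f is positive, lowering it is invertible, and f equals e raised by
-- one there exactly when the lowered f equals e; the factor f i j is then what turns e ! into the
-- factorial of the raised exponent.
δ-∂ : ∀ {n} (i j : Fin n) (e f : Monomial n) →
      fromℕ (f i j) * δ e (λ u v → f u v ∸ varExponent i j u v) ≡ δ (e ⊕ [ (i , j) ]) f
δ-∂ {n} i j e f = go (f i j) refl
  where
  a = [ (i , j) ]
  f∸ : Monomial n
  f∸ u v = f u v ∸ varExponent i j u v

  e⊕a : (e ⊕ a) i j ≡ suc (e i j)
  e⊕a = trans (cong (e i j ℕ.+_) (Arcs.count-∷-≡ (i , j) [])) (ℕ.+-comm (e i j) 1)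

  module _ {k} (fij : f i j ≡ suc k) where
    ω≤f : ∀ u v → ω a (u , v) ≤ f u v
    ω≤f u v with (u , v) ≟ᴬ (i , j)
    ... | yes refl = subst (1 ≤_) (sym fij) (s≤s z≤n)
    ... | no _     = z≤n

    raise : f∸ ≗ᴹ e → f ≗ᴹ e ⊕ a
    raise eq u v = trans (sym (ℕ.m∸n+n≡m (ω≤f u v)))
      (cong (ℕ._+ ω a (u , v)) (trans (cong (f u v ∸_) (sym (varExponent≡ω i j u v))) (eq u v)))

    lower : f ≗ᴹ e ⊕ a → f∸ ≗ᴹ e
    lower eq u v = trans (cong₂ _∸_ (eq u v) (varExponent≡ω i j u v)) (ℕ.m+n∸n≡m (e u v) (ω a (u , v)))

    factorial : f ≗ᴹ e ⊕ a → suc k ℕ.* e !ᴹ ≡ (e ⊕ a) !ᴹ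
    factorial eq = trans (cong (ℕ._* e !ᴹ) (trans (sym fij) (trans (eq i j) e⊕a))) (sym (!ᴹ-⊕ e i j))

  go : ∀ k → f i j ≡ k → fromℕ k * δ e f∸ ≡ δ (e ⊕ a) f
  -- Truncated subtraction leaves f unchanged here, but the factor 0 removes the left side; on the
  -- right, e ⊕ a has a positive exponent at (i , j) and cannot equal f.
  go zero fij = trans (ℚ.*-zeroˡ (δ e f∸)) (sym (trans
    (cong (_* fromℕ ((e ⊕ a) !ᴹ))
      (ℚ∑.𝟙-no (f ≟ᴹ (e ⊕ a)) λ eq → ℕ.0≢1+n (trans (sym fij) (trans (eq i j) e⊕a))))
    (ℚ.*-zeroˡ (fromℕ ((e ⊕ a) !ᴹ)))))
  go (suc k) fij = begin
    fromℕ (suc k) * (ℚ∑.𝟙 (f∸ ≟ᴹ e) * fromℕ (e !ᴹ))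
      ≡⟨ ℚ∑.*-leftSwap (fromℕ (suc k)) (ℚ∑.𝟙 (f∸ ≟ᴹ e)) (fromℕ (e !ᴹ)) ⟩
    ℚ∑.𝟙 (f∸ ≟ᴹ e) * (fromℕ (suc k) * fromℕ (e !ᴹ))
      ≡⟨ cong (_* (fromℕ (suc k) * fromℕ (e !ᴹ)))
              (ℚ∑.𝟙-⇔ (f∸ ≟ᴹ e) (f ≟ᴹ (e ⊕ a)) (raise fij) (lower fij)) ⟩
    ℚ∑.𝟙 (f ≟ᴹ (e ⊕ a)) * (fromℕ (suc k) * fromℕ (e !ᴹ))
      ≡⟨ ℚ∑.𝟙-cong (f ≟ᴹ (e ⊕ a)) (λ eq → trans (sym (fromℕ-homo-* (suc k) (e !ᴹ)))
           (cong fromℕ (factorial fij eq))) ⟩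
    ℚ∑.𝟙 (f ≟ᴹ (e ⊕ a)) * fromℕ ((e ⊕ a) !ᴹ) ∎

scaledCoeff : ∀ {n} → Polynomial n → Monomial n → ℚ
scaledCoeff p e = ⟨ p , δ e ⟩

scaledCoeff≡coeff : ∀ {n} (p : Polynomial n) e → scaledCoeff p e ≡ coeff p e * fromℕ (e !ᴹ)
scaledCoeff≡coeff p e = begin
  ℚ∑.∑ p (λ (q , f) → q * δ e f)
    ≡⟨ ℚ∑.∑-cong p (λ (q , f) → trans (sym (ℚ.*-assoc q _ _))
         (cong (_* fromℕ (e !ᴹ)) (select (f ≟ᴹ e) q))) ⟩
  ℚ∑.∑ p (λ (q , f) → (if does (f ≟ᴹ e) then q else 0ℚ) * fromℕ (e !ᴹ))
    ≡⟨ ℚ∑.*-distribʳ-∑ (fromℕ (e !ᴹ)) p _ ⟨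
  coeff p e * fromℕ (e !ᴹ) ∎
  where
  select : ∀ {P : Set} (P? : Dec P) q → q * ℚ∑.𝟙 P? ≡ (if does P? then q else 0ℚ)
  select (true  because _) q = ℚ.*-identityʳ q
  select (false because _) q = ℚ.*-zeroʳ q

pairing-cong : ∀ {n} (p : Polynomial n) {g g′ : Monomial n → ℚ} → (∀ f → g f ≡ g′ f) →
               ⟨ p , g ⟩ ≡ ⟨ p , g′ ⟩
pairing-cong p g≗g′ = ℚ∑.∑-cong p λ (q , f) → cong (q *_) (g≗g′ f)

pairing-sumᴾ : ∀ {A : Set} {n} (h : A → Polynomial n) xs g →
               ⟨ sumᴾ (map h xs) , g ⟩ ≡ ℚ∑.∑ xs (λ x → ⟨ h x , g ⟩)
pairing-sumᴾ h xs g = ℚ∑.∑-concat-map h xs _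

pairing-· : ∀ {n} q (p : Polynomial n) g → ⟨ q · p , g ⟩ ≡ q * ⟨ p , g ⟩
pairing-· q p g = begin
  ⟨ q · p , g ⟩                             ≡⟨ ℚ∑.∑-map _ p _ ⟩
  ℚ∑.∑ p (λ (r , f) → (q * r) * g f)        ≡⟨ ℚ∑.∑-cong p (λ (r , f) → ℚ.*-assoc q r (g f)) ⟩
  ℚ∑.∑ p (λ (r , f) → q * (r * g f))        ≡⟨ ℚ∑.*-distribˡ-∑ q p _ ⟨
  q * ⟨ p , g ⟩                             ∎

scaledCoeff-cong : ∀ {n} (p : Polynomial n) {e f} → e ≗ᴹ f → scaledCoeff p e ≡ scaledCoeff p f
scaledCoeff-cong p e≗f = pairing-cong p λ _ → δ-cong e≗f (λ _ _ → refl)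

scaledCoeff-∂ : ∀ {n} i j (p : Polynomial n) e →
                scaledCoeff (∂ i j p) e ≡ scaledCoeff p (e ⊕ [ (i , j) ])
scaledCoeff-∂ i j p e = trans (ℚ∑.∑-map _ p _)
  (ℚ∑.∑-cong p λ (q , f) → trans (ℚ.*-assoc q _ _) (cong (q *_) (δ-∂ i j e f)))

scaledCoeff-∂ʷ : ∀ {n k} i (α : Vec (Fin n) k) (p : Polynomial n) e →
                 scaledCoeff (∂ʷ i α p) e ≡ scaledCoeff p (e ⊕ map (i ,_) (toList α))
scaledCoeff-∂ʷ i []      p e = scaledCoeff-cong p λ u v → sym (ℕ.+-identityʳ (e u v))
scaledCoeff-∂ʷ i (a ∷ α) p e = begin
  scaledCoeff (∂ i a (∂ʷ i α p)) e
    ≡⟨ scaledCoeff-∂ i a (∂ʷ i α p) e ⟩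
  scaledCoeff (∂ʷ i α p) (e ⊕ [ (i , a) ])
    ≡⟨ scaledCoeff-∂ʷ i α p (e ⊕ [ (i , a) ]) ⟩
  scaledCoeff p (e ⊕ [ (i , a) ] ⊕ map (i ,_) (toList α))
    ≡⟨ scaledCoeff-cong p (λ u v → sym (⊕-++ e [ (i , a) ] (map (i ,_) (toList α)) u v)) ⟩
  scaledCoeff p (e ⊕ map (i ,_) (toList (a ∷ α))) ∎

ω-∷ : ∀ {n} (x : Arc n) D u v → ω (x ∷ D) (u , v) ≡ ω [ x ] (u , v) ℕ.+ ω D (u , v)
ω-∷ x D u v = Arcs.count-++ (u , v) [ x ] D

pairing-const : ∀ {n} q (g : Monomial n → ℚ) → ⟨ const q , g ⟩ ≡ q * g 𝟎
pairing-const q g = ℚ.+-identityʳ (q * g 𝟎)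

pairing-var-*ᴾ : ∀ {n} i l (p : Polynomial n) g →
                 ⟨ var i l *ᴾ p , g ⟩ ≡ ⟨ p , (λ f → g (λ u v → varExponent i l u v ℕ.+ f u v)) ⟩
pairing-var-*ᴾ i l p g = begin
  ⟨ var i l *ᴾ p , g ⟩
    ≡⟨ ℚ∑.∑-cartesianProductWith (λ (q , e) (r , f) → q * r , λ u v → e u v ℕ.+ f u v)
         (var i l) p (λ (q , f) → q * g f) ⟩
  ℚ∑.∑ p (λ (q , f) → (1ℚ * q) * g (λ u v → varExponent i l u v ℕ.+ f u v)) + 0ℚ
    ≡⟨ ℚ.+-identityʳ _ ⟩
  ℚ∑.∑ p (λ (q , f) → (1ℚ * q) * g (λ u v → varExponent i l u v ℕ.+ f u v))
    ≡⟨ ℚ∑.∑-cong p (λ (q , f) → cong (_* g (λ u v → varExponent i l u v ℕ.+ f u v)) (ℚ.*-identityˡ q)) ⟩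
  ℚ∑.∑ p (λ (q , f) → q * g (λ u v → varExponent i l u v ℕ.+ f u v)) ∎

-- Exponents are functions compared pointwise, so compatibility has to be carried as a hypothesis
-- when different expressions for one monomial are exchanged.
Respects-≗ᴹ : ∀ {n} → (Monomial n → ℚ) → Set
Respects-≗ᴹ g = ∀ {e f} → e ≗ᴹ f → g e ≡ g f

-- The entries of the powers of A are the generating polynomials of walks; w lists the vertices
-- after the start i. The functional g is arbitrary because peeling off the first arc changes it:
-- the induction hypothesis is applied to g precomposed with multiplication by a i l.
pairing-var^ᴹ : ∀ {n} k (i j : Fin n) (g : Monomial n → ℚ) → Respects-≗ᴹ g →
  ⟨ (var ^ᴹ k) i j , g ⟩ ≡
  ℚ∑.∑ (words n k) (λ w → ℚ∑.𝟙 (Vec.last (i ∷ w) ≟ᶠ j) * g (monomial (arcsOfWalk (i ∷ w))))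
pairing-var^ᴹ {n} zero i j g g-cong = trans (entry (i ≟ᶠ j)) (sym (ℚ.+-identityʳ _))
  where
  entry : ∀ {P : Set} (P? : Dec P) →
          ⟨ (if does P? then const 1ℚ else const 0ℚ) , g ⟩ ≡ ℚ∑.𝟙 P? * g (monomial [])
  entry (true  because _) = pairing-const 1ℚ g
  entry (false because _) = pairing-const 0ℚ g
pairing-var^ᴹ {n} (suc k) i j g g-cong = begin
  ⟨ sumᴾ (map (λ l → var i l *ᴾ (var ^ᴹ k) l j) (allFin n)) , g ⟩
    ≡⟨ pairing-sumᴾ (λ l → var i l *ᴾ (var ^ᴹ k) l j) (allFin n) g ⟩
  ℚ∑.∑ (allFin n) (λ l → ⟨ var i l *ᴾ (var ^ᴹ k) l j , g ⟩)
    ≡⟨ ℚ∑.∑-cong (allFin n) (λ l → trans (pairing-var-*ᴾ i l ((var ^ᴹ k) l j) g)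
         (trans (pairing-var^ᴹ k l j _ (λ e≗f → g-cong (λ u v → cong (varExponent i l u v ℕ.+_) (e≗f u v))))
                (ℚ∑.∑-cong (words n k) (λ w → cong (ℚ∑.𝟙 (Vec.last (l ∷ w) ≟ᶠ j) *_) (g-cong (prepend l w)))))) ⟩
  ℚ∑.∑ (allFin n) (λ l → ℚ∑.∑ (words n k) (λ w → term (l ∷ w)))
    ≡⟨ ℚ∑.∑-cartesianProductWith _∷_ (allFin n) (words n k) term ⟨
  ℚ∑.∑ (words n (suc k)) term ∎
  where
  term : Vec (Fin n) (suc k) → ℚ
  term w = ℚ∑.𝟙 (Vec.last (i ∷ w) ≟ᶠ j) * g (monomial (arcsOfWalk (i ∷ w)))

  prepend : ∀ l w → (λ u v → varExponent i l u v ℕ.+ monomial (arcsOfWalk (l ∷ w)) u v) ≗ᴹ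
                    monomial (arcsOfWalk (i ∷ l ∷ w))
  prepend l w u v = trans (cong (ℕ._+ ω (arcsOfWalk (l ∷ w)) (u , v)) (varExponent≡ω i l u v))
    (sym (ω-∷ (i , l) (arcsOfWalk (l ∷ w)) u v))

-- Letters of edge words, stars and sorting

∈-letters⁺ : ∀ {n k} (v : Vec (Fin n) k) {a} → a ∈ toList v → a ∈ˢ letters v
∈-letters⁺ (x ∷ v) (here refl) = Subset.p⊆p∪q (letters v) (Subset.x∈⁅x⁆ x)
∈-letters⁺ (x ∷ v) (there a∈)  = Subset.q⊆p∪q ⁅ x ⁆ (letters v) (∈-letters⁺ v a∈)

∈-letters⁻ : ∀ {n k} (v : Vec (Fin n) k) {a} → a ∈ˢ letters v → a ∈ toList v
∈-letters⁻ []      a∈ = contradiction a∈ Subset.∉⊥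
∈-letters⁻ (x ∷ v) a∈ with Subset.x∈p∪q⁻ ⁅ x ⁆ (letters v) a∈
... | inj₁ a∈x = here (Subset.x∈⁅y⁆⇒x≡y x a∈x)
... | inj₂ a∈v = there (∈-letters⁻ v a∈v)

letters-cong : ∀ {n k} {v w : Vec (Fin n) k} → v ∼ w → letters v ≡ letters w
letters-cong {v = v} {w} v∼w = Subset.⊆-antisym (sub v w v∼w) (sub w v (sym ∘ v∼w))
  where
  sub : ∀ {n k} (v w : Vec (Fin n) k) → v ∼ w → ∀ {a} → a ∈ˢ letters v → a ∈ˢ letters w
  sub v w v∼w {a} a∈ = ∈-letters⁺ w (count>0⇒∈ (toList w)
    (subst (0 ℕ.<_) (v∼w a) (∈⇒count>0 (∈-letters⁻ v a∈))))

∣⁅x⁆∪q∣≤1+∣q∣ : ∀ {n} (x : Fin n) q → ∣ ⁅ x ⁆ ∪ q ∣ ≤ suc ∣ q ∣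
∣⁅x⁆∪q∣≤1+∣q∣ zero    (s ∷ q) rewrite Subset.∪-identityˡ q = s≤s (Subset.∣p∣≤∣x∷p∣ s q)
∣⁅x⁆∪q∣≤1+∣q∣ (suc x) (inside  ∷ q) = s≤s (∣⁅x⁆∪q∣≤1+∣q∣ x q)
∣⁅x⁆∪q∣≤1+∣q∣ (suc x) (outside ∷ q) = ∣⁅x⁆∪q∣≤1+∣q∣ x q

x∈q⇒⁅x⁆∪q≡q : ∀ {n} {x : Fin n} {q} → x ∈ˢ q → ⁅ x ⁆ ∪ q ≡ q
x∈q⇒⁅x⁆∪q≡q {x = x} {q} x∈q = Subset.⊆-antisym
  (λ y∈ → absorb (Subset.x∈p∪q⁻ ⁅ x ⁆ q y∈)) (Subset.q⊆p∪q ⁅ x ⁆ q)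
  where
  absorb : ∀ {y} → _ → y ∈ˢ q
  absorb (inj₁ y∈x) = subst (_∈ˢ q) (sym (Subset.x∈⁅y⁆⇒x≡y x y∈x)) x∈q
  absorb (inj₂ y∈q) = y∈q

∣letters∣≤length : ∀ {n k} (v : Vec (Fin n) k) → ∣ letters v ∣ ≤ k
∣letters∣≤length {n} [] = ℕ.≤-reflexive (Subset.∣⊥∣≡0 n)
∣letters∣≤length (x ∷ v) = ℕ.≤-trans (∣⁅x⁆∪q∣≤1+∣q∣ x (letters v)) (s≤s (∣letters∣≤length v))

-- A first letter that recurs later adds nothing to the set of letters, which would then be smaller
-- than the length of the word.
length≤∣letters∣⇒distinct : ∀ {n k} (v : Vec (Fin n) k) → k ≤ ∣ letters v ∣ →
                            ∀ a → count a (toList v) ≤ 1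
length≤∣letters∣⇒distinct []      _  a = z≤n
length≤∣letters∣⇒distinct {k = suc k} (x ∷ v) k< a with a ≟ᶠ x
... | yes refl = s≤s (ℕ.≤-reflexive (cong length (filter-none (a ≟ᶠ_) (All.¬Any⇒All¬ (toList v) x∉))))
  where
  x∉ : ¬ (a ∈ toList v)
  x∉ a∈ = ℕ.<⇒≱ k< (subst (λ p → ∣ p ∣ ≤ k) (sym (x∈q⇒⁅x⁆∪q≡q (∈-letters⁺ v a∈))) (∣letters∣≤length v))
... | no _ = length≤∣letters∣⇒distinct v (ℕ.s≤s⁻¹ (ℕ.≤-trans k< (∣⁅x⁆∪q∣≤1+∣q∣ x (letters v)))) a

ω-star : ∀ {n} (i : Fin n) xs u v → ω (map (i ,_) xs) (u , v) ≡ ℕ∑.𝟙 (u ≟ᶠ i) ℕ.* count v xs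
ω-star i []       u v = sym (ℕ.*-zeroʳ (ℕ∑.𝟙 (u ≟ᶠ i)))
ω-star i (x ∷ xs) u v = begin
  ω ((i , x) ∷ map (i ,_) xs) (u , v)
    ≡⟨ Arcs.count-∷ (u , v) (i , x) (map (i ,_) xs) ⟩
  ℕ∑.𝟙 ((u , v) ≟ᴬ (i , x)) ℕ.+ ω (map (i ,_) xs) (u , v)
    ≡⟨ cong₂ ℕ._+_ (trans (ℕ∑.𝟙-⇔ ((u , v) ≟ᴬ (i , x)) ((u ≟ᶠ i) ×-dec (v ≟ᶠ x))
                            (λ { refl → refl , refl }) (λ { (refl , refl) → refl }))
                          (ℕ∑.𝟙-× (u ≟ᶠ i) (v ≟ᶠ x)))
                   (ω-star i xs u v) ⟩
  ℕ∑.𝟙 (u ≟ᶠ i) ℕ.* ℕ∑.𝟙 (v ≟ᶠ x) ℕ.+ ℕ∑.𝟙 (u ≟ᶠ i) ℕ.* count v xs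
    ≡⟨ ℕ.*-distribˡ-+ (ℕ∑.𝟙 (u ≟ᶠ i)) (ℕ∑.𝟙 (v ≟ᶠ x)) (count v xs) ⟨
  ℕ∑.𝟙 (u ≟ᶠ i) ℕ.* (ℕ∑.𝟙 (v ≟ᶠ x) ℕ.+ count v xs)
    ≡⟨ cong (ℕ∑.𝟙 (u ≟ᶠ i) ℕ.*_) (count-∷ v x xs) ⟨
  ℕ∑.𝟙 (u ≟ᶠ i) ℕ.* count v (x ∷ xs) ∎

-- The arcs contributed by one component iα of F; `multiDigraph` is the concatenation of these
-- stars.
star : ∀ {n k} → Fin n → Vec (Fin n) k → MultiDigraph n
star i α = map (i ,_) (toList α)

⊕-star-cong : ∀ {n k} (e : Monomial n) i {α β : Vec (Fin n) k} → α ∼ β → e ⊕ star i α ≗ᴹ e ⊕ star i β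
⊕-star-cong e i {α} {β} α∼β u v = cong (e u v ℕ.+_) (begin
  ω (star i α) (u , v)                      ≡⟨ ω-star i (toList α) u v ⟩
  ℕ∑.𝟙 (u ≟ᶠ i) ℕ.* count v (toList α)      ≡⟨ cong (ℕ∑.𝟙 (u ≟ᶠ i) ℕ.*_) (α∼β v) ⟩
  ℕ∑.𝟙 (u ≟ᶠ i) ℕ.* count v (toList β)      ≡⟨ ω-star i (toList β) u v ⟨
  ω (star i β) (u , v)                      ∎)

∼-∷ : ∀ {n k} i {α β : Vec (Fin n) k} → α ∼ β → i ∷ α ∼ i ∷ β
∼-∷ i {α} {β} α∼β a = trans (count-∷ a i (toList α))
  (trans (cong (ℕ∑.𝟙 (a ≟ᶠ i) ℕ.+_) (α∼β a)) (sym (count-∷ a i (toList β))))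

-- Groups words into rearrangement classes, each represented by its only ascending member and
-- weighted by its size. The size is left unevaluated, since it is k ! only for words with distinct
-- letters.
∑-by-sorting : ∀ {n k} (g : Vec (Fin n) k → ℚ) → (∀ {α β} → α ∼ β → g α ≡ g β) →
  ℚ∑.∑ (words n k) g ≡
  ℚ∑.∑ (words n k) (λ β → (ℚ∑.𝟙 (ascending? β) * fromℕ (ℕ∑.∑ (words n k) (λ α → ℕ∑.𝟙 (α ∼? β)))) * g β)
∑-by-sorting {n} {k} g g-cong = begin
  ℚ∑.∑ W g
    ≡⟨ ℚ∑.∑-cong W sorted ⟩
  ℚ∑.∑ W (λ α → ℚ∑.∑ W (λ β → ℚ∑.𝟙 (ascending? β ×-dec (α ∼? β)) * g β))
    ≡⟨ ℚ∑.∑-swap W W _ ⟩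
  ℚ∑.∑ W (λ β → ℚ∑.∑ W (λ α → ℚ∑.𝟙 (ascending? β ×-dec (α ∼? β)) * g β))
    ≡⟨ ℚ∑.∑-cong W (λ β → trans (sym (ℚ∑.*-distribʳ-∑ (g β) W _)) (cong (_* g β) (begin
         ℚ∑.∑ W (λ α → ℚ∑.𝟙 (ascending? β ×-dec (α ∼? β)))
           ≡⟨ ℚ∑.∑-cong W (λ α → ℚ∑.𝟙-× (ascending? β) (α ∼? β)) ⟩
         ℚ∑.∑ W (λ α → ℚ∑.𝟙 (ascending? β) * ℚ∑.𝟙 (α ∼? β))
           ≡⟨ ℚ∑.*-distribˡ-∑ (ℚ∑.𝟙 (ascending? β)) W _ ⟨
         ℚ∑.𝟙 (ascending? β) * ℚ∑.∑ W (λ α → ℚ∑.𝟙 (α ∼? β))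
           ≡⟨ cong (ℚ∑.𝟙 (ascending? β) *_) (fromℕ-∑-𝟙 (_∼? β) W) ⟨
         ℚ∑.𝟙 (ascending? β) * fromℕ (ℕ∑.∑ W (λ α → ℕ∑.𝟙 (α ∼? β))) ∎))) ⟩
  ℚ∑.∑ W (λ β → (ℚ∑.𝟙 (ascending? β) * fromℕ (ℕ∑.∑ W (λ α → ℕ∑.𝟙 (α ∼? β)))) * g β) ∎
  where
  W = words n k
  sorted : ∀ α → g α ≡ ℚ∑.∑ W (λ β → ℚ∑.𝟙 (ascending? β ×-dec (α ∼? β)) * g β)
  sorted α with sort (λ a → count a (toList α)) (trans (∑-count (Unique.allFin⁺ n) ∈-allFin (toList α)) (Vec.length-toList α))
  ... | β , _ , asc , same = trans (g-cong (sym ∘ same)) (sym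
    (ℚ∑.∑-𝟙-unique (λ β → ascending? β ×-dec (α ∼? β)) g
      (vectors-unique k (Unique.allFin⁺ n)) (∈-vectors ∈-allFin β) (asc , sym ∘ same)
      (λ (asc′ , α∼) → ascending-unique asc′ asc (λ a → trans (sym (α∼ a)) (sym (same a))))))

-- Tensor derivatives

if≡𝟙* : ∀ {P : Set} (P? : Dec P) q → (if does P? then q else 0ℚ) ≡ ℚ∑.𝟙 P? * q
if≡𝟙* (true  because _) q = sym (ℚ.*-identityˡ q)
if≡𝟙* (false because _) q = sym (ℚ.*-zeroˡ q)

fold≡foldr : ∀ {A B : Set} (f : A → B → B) z a k → fold z (f a) k ≡ foldr f z (replicate k a)
fold≡foldr f z a zero    = refl
fold≡foldr f z a (suc k) = cong (f a) (fold≡foldr f z a k)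

module _ {n m : ℕ} (H : UniformHypergraph n m) where
  open UniformHypergraph H

  good? : ∀ i (α : Vec (Fin n) (m ∸ 1)) → Dec (Edge (letters (i ∷ α)) × Ascending α)
  good? i α = edge? (letters (i ∷ α)) ×-dec ascending? α

  edge⇒distinct : ∀ i (α : Vec (Fin n) (m ∸ 1)) → Edge (letters (i ∷ α)) → ∀ a → count a (toList α) ≤ 1
  edge⇒distinct i α edge a = ℕ.≤-trans
    (ℕ.≤-trans (ℕ.m≤n+m _ _) (ℕ.≤-reflexive (sym (count-∷ a i (toList α)))))
    (length≤∣letters∣⇒distinct (i ∷ α)
      -- `2≤m` makes m ∸ 1 an honest predecessor, so the word i ∷ α has length m, the size of the
      -- edge.
      (ℕ.≤-reflexive (trans (ℕ.m+[n∸m]≡n (ℕ.≤-trans (s≤s z≤n) 2≤m)) (sym (uniform _ edge)))) a)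

  h-cong : ∀ i {α β} → α ∼ β → h H i α ≡ h H i β
  h-cong i {α} {β} α∼β = cong (λ e → if does (edge? e) then 1/ (m ∸ 1) ! else 0ℚ)
    (letters-cong {v = i ∷ α} {i ∷ β} (∼-∷ i {α} {β} α∼β))

  ∑-h : ∀ i (g : Vec (Fin n) (m ∸ 1) → ℚ) → (∀ {α β} → α ∼ β → g α ≡ g β) →
        ℚ∑.∑ (words n (m ∸ 1)) (λ α → h H i α * g α) ≡
        ℚ∑.∑ (words n (m ∸ 1)) (λ α → ℚ∑.𝟙 (good? i α) * g α)
  ∑-h i g g-cong = trans
    (∑-by-sorting (λ α → h H i α * g α) (λ {α} {β} α∼β → cong₂ _*_ (h-cong i {α} {β} α∼β) (g-cong α∼β)))
    (ℚ∑.∑-cong (words n (m ∸ 1)) perSorted)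
    where
    perSorted : ∀ β → (ℚ∑.𝟙 (ascending? β) * fromℕ (ℕ∑.∑ (words n (m ∸ 1)) (λ α → ℕ∑.𝟙 (α ∼? β)))) * (h H i β * g β)
                      ≡ ℚ∑.𝟙 (good? i β) * g β
    perSorted β = begin
      (A * N) * (h H i β * g β)
        ≡⟨ ℚ.*-assoc (A * N) (h H i β) (g β) ⟨
      ((A * N) * h H i β) * g β
        ≡⟨ cong (_* g β) (begin
             (A * N) * h H i β           ≡⟨ cong ((A * N) *_) (if≡𝟙* (edge? (letters (i ∷ β))) 1/k!) ⟩
             (A * N) * (E * 1/k!)        ≡⟨ ℚ∑.*-leftSwap (A * N) E 1/k! ⟩
             -- The class size N is (m - 1) ! for edge words, whose letters are distinct; all other
             -- words are already removed by E.
             E * ((A * N) * 1/k!)        ≡⟨ ℚ∑.𝟙-cong (edge? (letters (i ∷ β))) cancel ⟩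
             E * A                       ≡⟨ ℚ∑.𝟙-× (edge? (letters (i ∷ β))) (ascending? β) ⟨
             ℚ∑.𝟙 (good? i β)            ∎) ⟩
      ℚ∑.𝟙 (good? i β) * g β ∎
      where
      A = ℚ∑.𝟙 (ascending? β)
      N = fromℕ (ℕ∑.∑ (words n (m ∸ 1)) (λ α → ℕ∑.𝟙 (α ∼? β)))
      E = ℚ∑.𝟙 (edge? (letters (i ∷ β)))
      1/k! = 1/ (m ∸ 1) !
      cancel : Edge (letters (i ∷ β)) → (A * N) * 1/k! ≡ A
      cancel edge = begin
        (A * N) * 1/k!
          ≡⟨ ℚ.*-assoc A N 1/k! ⟩
        A * (N * 1/k!)
          ≡⟨ cong (λ x → A * (fromℕ x * 1/k!)) (∑-rearrangements β (edge⇒distinct i β edge)) ⟩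
        A * (fromℕ ((m ∸ 1) !) * 1/k!)
          ≡⟨ cong (A *_) (trans (ℚ.*-comm (fromℕ ((m ∸ 1) !)) 1/k!) (/-* 1 ((m ∸ 1) !) {{(m ∸ 1) ℕ.!≢0}})) ⟩
        A * 1ℚ
          ≡⟨ ℚ.*-identityʳ A ⟩
        A ∎

  -- The effect of `tensorDerivative` on the function of all scaled coefficients: the tensor entries
  -- have cancelled against rearrangements, leaving shifts by stars of ascending edge words.
  shiftSum : Fin n → (Monomial n → ℚ) → Monomial n → ℚ
  shiftSum i f e = ℚ∑.∑ (words n (m ∸ 1)) (λ α → ℚ∑.𝟙 (good? i α) * f (e ⊕ star i α))

  shiftSums : (Monomial n → ℚ) → List (Fin n) → Monomial n → ℚ
  shiftSums = foldr shiftSum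

  scaledCoeff-tensorDerivative : ∀ i p e →
    scaledCoeff (tensorDerivative H i p) e ≡ shiftSum i (scaledCoeff p) e
  scaledCoeff-tensorDerivative i p e = begin
    scaledCoeff (tensorDerivative H i p) e
      ≡⟨ pairing-sumᴾ (λ α → h H i α · ∂ʷ i α p) (words n (m ∸ 1)) (δ e) ⟩
    ℚ∑.∑ (words n (m ∸ 1)) (λ α → scaledCoeff (h H i α · ∂ʷ i α p) e)
      ≡⟨ ℚ∑.∑-cong (words n (m ∸ 1)) (λ α → trans (pairing-· (h H i α) (∂ʷ i α p) (δ e))
           (cong (h H i α *_) (scaledCoeff-∂ʷ i α p e))) ⟩
    ℚ∑.∑ (words n (m ∸ 1)) (λ α → h H i α * scaledCoeff p (e ⊕ star i α))
      ≡⟨ ∑-h i (λ α → scaledCoeff p (e ⊕ star i α))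
           (λ {α} {β} α∼β → scaledCoeff-cong p (⊕-star-cong e i {α} {β} α∼β)) ⟩
    shiftSum i (scaledCoeff p) e ∎

  shiftSum-cong : ∀ i {f g} → (∀ e → f e ≡ g e) → ∀ e → shiftSum i f e ≡ shiftSum i g e
  shiftSum-cong i f≗g e = ℚ∑.∑-cong (words n (m ∸ 1)) λ α → cong (ℚ∑.𝟙 (good? i α) *_) (f≗g (e ⊕ star i α))

  shiftSum-* : ∀ i q f e → shiftSum i (λ e → q * f e) e ≡ q * shiftSum i f e
  shiftSum-* i q f e = trans
    (ℚ∑.∑-cong (words n (m ∸ 1)) (λ α → ℚ∑.*-leftSwap (ℚ∑.𝟙 (good? i α)) q (f (e ⊕ star i α))))
    (sym (ℚ∑.*-distribˡ-∑ q (words n (m ∸ 1)) _))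

  shiftSums-cong : ∀ is {f g} → (∀ e → f e ≡ g e) → ∀ e → shiftSums f is e ≡ shiftSums g is e
  shiftSums-cong []       f≗g = f≗g
  shiftSums-cong (i ∷ is) f≗g = shiftSum-cong i (shiftSums-cong is f≗g)

  shiftSums-* : ∀ is q f e → shiftSums (λ e → q * f e) is e ≡ q * shiftSums f is e
  shiftSums-* []       q f e = refl
  shiftSums-* (i ∷ is) q f e = trans (shiftSum-cong i (shiftSums-* is q f) e) (shiftSum-* i q (shiftSums f is) e)

  scaledCoeff-tensorDerivatives : ∀ is p e →
    scaledCoeff (foldr (tensorDerivative H) p is) e ≡ shiftSums (scaledCoeff p) is e
  scaledCoeff-tensorDerivatives []       p e = refl
  scaledCoeff-tensorDerivatives (i ∷ is) p e =
    trans (scaledCoeff-tensorDerivative i (foldr (tensorDerivative H) p is) e)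
          (shiftSum-cong i (scaledCoeff-tensorDerivatives is p) e)

  -- The factors 1/(dᵢ(m - 1))! collected from a summand of `μ`; `b/c≡` identifies their product
  -- with 1 / c(F).
  weight : (Fin n → ℕ) → List (Fin n) → ℚ
  weight c = foldr (λ i q → 1/ (c i ℕ.* (m ∸ 1)) ! * q) 1ℚ

  -- The rational factors sit between the iterated operators. Shifts are linear, so the factors move
  -- to the front, and the iterates join into one list of shifts.
  scaledCoeff-summand : ∀ c p is e →
    scaledCoeff (foldr (λ i p → 1/ (c i ℕ.* (m ∸ 1)) ! · fold p (tensorDerivative H i) (c i)) p is) e ≡
    weight c is * shiftSums (scaledCoeff p) (blocks is c) e
  scaledCoeff-summand c p []       e = sym (ℚ.*-identityˡ _)
  scaledCoeff-summand c p (i ∷ is) e = begin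
    scaledCoeff (x · fold p′ (tensorDerivative H i) (c i)) e
      ≡⟨ pairing-· x (fold p′ (tensorDerivative H i) (c i)) (δ e) ⟩
    x * scaledCoeff (fold p′ (tensorDerivative H i) (c i)) e
      ≡⟨ cong (λ r → x * scaledCoeff r e) (fold≡foldr (tensorDerivative H) p′ i (c i)) ⟩
    x * scaledCoeff (foldr (tensorDerivative H) p′ (replicate (c i) i)) e
      ≡⟨ cong (x *_) (scaledCoeff-tensorDerivatives (replicate (c i) i) p′ e) ⟩
    x * shiftSums (scaledCoeff p′) (replicate (c i) i) e
      ≡⟨ cong (x *_) (shiftSums-cong (replicate (c i) i) (scaledCoeff-summand c p is) e) ⟩
    x * shiftSums (λ e → weight c is * rest e) (replicate (c i) i) e
      ≡⟨ cong (x *_) (shiftSums-* (replicate (c i) i) (weight c is) rest e) ⟩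
    x * (weight c is * shiftSums rest (replicate (c i) i) e)
      ≡⟨ ℚ.*-assoc x (weight c is) _ ⟨
    (x * weight c is) * shiftSums rest (replicate (c i) i) e
      ≡⟨ cong (λ g → (x * weight c is) * g e) (foldr-++ shiftSum (scaledCoeff p) (replicate (c i) i) (blocks is c)) ⟨
    (x * weight c is) * shiftSums (scaledCoeff p) (blocks (i ∷ is) c) e ∎
    where
    x = 1/ (c i ℕ.* (m ∸ 1)) !
    p′ = foldr (λ i p → 1/ (c i ℕ.* (m ∸ 1)) ! · fold p (tensorDerivative H i) (c i)) p is
    rest = shiftSums (scaledCoeff p) (blocks is c)

  Good : ∀ {d} → Sequence n m d → Set
  Good F = Vecᴬ.All (λ (i , α) → Edge (letters (i ∷ α)) × Ascending α) F

  allGood? : ∀ {d} (F : Sequence n m d) → Dec (Good F)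
  allGood? = Vecᴬ.all? (λ (i , α) → good? i α)

  -- Expands nested shift sums into one sum over sequences F. The weight `G` depends on the whole
  -- index word and so cannot be split off letter by letter; the induction passes to the weight of i
  -- ∷ is, and moves e by the star of the first component.
  ∑-sequences : ∀ d (G : Vec (Fin n) d → ℚ) f → Respects-≗ᴹ f → ∀ e →
    ℚ∑.∑ (sequences n m d) (λ F → G (Vec.map proj₁ F) * (ℚ∑.𝟙 (allGood? F) * f (e ⊕ multiDigraph m F))) ≡
    ℚ∑.∑ (words n d) (λ is → G is * shiftSums f (toList is) e)
  ∑-sequences zero G f f-cong e = cong (λ x → G [] * x + 0ℚ)
    (trans (ℚ.*-identityˡ _) (f-cong λ u v → ℕ.+-identityʳ (e u v)))
  ∑-sequences (suc d) G f f-cong e = begin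
    ℚ∑.∑ (sequences n m (suc d)) (term G e)
      ≡⟨ ℚ∑.∑-cartesianProductWith _∷_ (cartesianProduct (allFin n) W) (sequences n m d) (term G e) ⟩
    ℚ∑.∑ (cartesianProduct (allFin n) W) (λ iα → ℚ∑.∑ (sequences n m d) (λ F → term G e (iα ∷ F)))
      ≡⟨ ℚ∑.∑-cartesianProductWith _,_ (allFin n) W (λ iα → ℚ∑.∑ (sequences n m d) (λ F → term G e (iα ∷ F))) ⟩
    ℚ∑.∑ (allFin n) (λ i → ℚ∑.∑ W (λ α → ℚ∑.∑ (sequences n m d) (λ F → term G e ((i , α) ∷ F))))
      ≡⟨ ℚ∑.∑-cong (allFin n) (λ i → ℚ∑.∑-cong W (λ α → perArc i α)) ⟩
    ℚ∑.∑ (allFin n) (λ i → ℚ∑.∑ W (λ α → ℚ∑.∑ (words n d) (λ is → G (i ∷ is) * (ℚ∑.𝟙 (good? i α) * S is (e ⊕ star i α)))))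
      ≡⟨ ℚ∑.∑-cong (allFin n) (λ i → trans (ℚ∑.∑-swap W (words n d) _)
           (ℚ∑.∑-cong (words n d) (λ is → sym (ℚ∑.*-distribˡ-∑ (G (i ∷ is)) W _)))) ⟩
    ℚ∑.∑ (allFin n) (λ i → ℚ∑.∑ (words n d) (λ is → G (i ∷ is) * shiftSums f (toList (i ∷ is)) e))
      ≡⟨ ℚ∑.∑-cartesianProductWith _∷_ (allFin n) (words n d) (λ is → G is * shiftSums f (toList is) e) ⟨
    ℚ∑.∑ (words n (suc d)) (λ is → G is * shiftSums f (toList is) e) ∎
    where
    W = words n (m ∸ 1)
    term : ∀ {d} → (Vec (Fin n) d → ℚ) → Monomial n → Sequence n m d → ℚ
    term G e F = G (Vec.map proj₁ F) * (ℚ∑.𝟙 (allGood? F) * f (e ⊕ multiDigraph m F))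
    S : ∀ {d} → Vec (Fin n) d → Monomial n → ℚ
    S is = shiftSums f (toList is)

    perArc : ∀ i α → ℚ∑.∑ (sequences n m d) (λ F → term G e ((i , α) ∷ F)) ≡
                     ℚ∑.∑ (words n d) (λ is → G (i ∷ is) * (ℚ∑.𝟙 (good? i α) * S is (e ⊕ star i α)))
    perArc i α = begin
      ℚ∑.∑ (sequences n m d) (λ F → term G e ((i , α) ∷ F))
        ≡⟨ ℚ∑.∑-cong (sequences n m d) (λ F → split F) ⟩
      ℚ∑.∑ (sequences n m d) (λ F → g * term (λ is → G (i ∷ is)) (e ⊕ star i α) F)
        ≡⟨ ℚ∑.*-distribˡ-∑ g (sequences n m d) _ ⟨
      g * ℚ∑.∑ (sequences n m d) (term (λ is → G (i ∷ is)) (e ⊕ star i α))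
        ≡⟨ cong (g *_) (∑-sequences d (λ is → G (i ∷ is)) f f-cong (e ⊕ star i α)) ⟩
      g * ℚ∑.∑ (words n d) (λ is → G (i ∷ is) * S is (e ⊕ star i α))
        ≡⟨ ℚ∑.*-distribˡ-∑ g (words n d) _ ⟩
      ℚ∑.∑ (words n d) (λ is → g * (G (i ∷ is) * S is (e ⊕ star i α)))
        ≡⟨ ℚ∑.∑-cong (words n d) (λ is → ℚ∑.*-leftSwap g (G (i ∷ is)) (S is (e ⊕ star i α))) ⟩
      ℚ∑.∑ (words n d) (λ is → G (i ∷ is) * (g * S is (e ⊕ star i α))) ∎
      where
      g = ℚ∑.𝟙 (good? i α)
      split : ∀ F → term G e ((i , α) ∷ F) ≡ g * term (λ is → G (i ∷ is)) (e ⊕ star i α) F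
      split F = begin
        Gᵢ * (ℚ∑.𝟙 (good? i α ×-dec allGood? F) * f (e ⊕ multiDigraph m ((i , α) ∷ F)))
          ≡⟨ cong₂ (λ x y → Gᵢ * (x * y)) (ℚ∑.𝟙-× (good? i α) (allGood? F))
                   (f-cong (⊕-++ e (star i α) (multiDigraph m F))) ⟩
        Gᵢ * ((g * a) * r)
          ≡⟨ cong (Gᵢ *_) (ℚ.*-assoc g a r) ⟩
        Gᵢ * (g * (a * r))
          ≡⟨ ℚ∑.*-leftSwap Gᵢ g (a * r) ⟩
        g * (Gᵢ * (a * r)) ∎
        where
        Gᵢ = G (i ∷ Vec.map proj₁ F)
        a = ℚ∑.𝟙 (allGood? F)
        r = f (e ⊕ star i α ⊕ multiDigraph m F)

-- Compositions and closed walks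

∈-vectors⁺ : ∀ {A : Set} {xs : List A} {k} (v : Vec A k) → (∀ i → lookup v i ∈ xs) → v ∈ vectors xs k
∈-vectors⁺ []      _  = here refl
∈-vectors⁺ (x ∷ v) v∈ = ∈-cartesianProductWith⁺ _∷_ (v∈ zero) (∈-vectors⁺ v (v∈ ∘ suc))

sum≡∑ : ∀ {n} (v : Vec ℕ n) → Vec.sum v ≡ ℕ∑.∑ (allFin n) (lookup v)
sum≡∑ v = go v id (λ _ → refl)
  where
  go : ∀ {k} {A : Set} {f : A → ℕ} (v : Vec ℕ k) (g : Fin k → A) → (∀ i → lookup v i ≡ f (g i)) →
       Vec.sum v ≡ ℕ∑.∑ (tabulate g) f
  go []      g eq = refl
  go (x ∷ v) g eq = cong₂ ℕ._+_ (eq zero) (go v (g ∘ suc) (eq ∘ suc))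

∑≡0⇒≡0 : ∀ {A : Set} {xs : List A} {x} (f : A → ℕ) → ℕ∑.∑ xs f ≡ 0 → x ∈ xs → f x ≡ 0
∑≡0⇒≡0 {xs = y ∷ xs} f eq (here refl) = ℕ.m+n≡0⇒m≡0 (f y) eq
∑≡0⇒≡0 {xs = y ∷ xs} f eq (there x∈)  = ∑≡0⇒≡0 {xs = xs} f (ℕ.m+n≡0⇒n≡0 (f y) eq) x∈

counts : ∀ {n k} → Vec (Fin n) k → Vec ℕ n
counts v = Vec.tabulate (λ a → count a (toList v))

lookup-counts : ∀ {n k} (v : Vec (Fin n) k) a → lookup (counts v) a ≡ count a (toList v)
lookup-counts v a = Vec.lookup∘tabulate _ a

counts-∈-compositions : ∀ {n d} (v : Vec (Fin n) d) → counts v ∈ compositions n d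
counts-∈-compositions {n} {d} v = ∈-filter⁺ (λ ds → Vec.sum ds ℕ.≟ d)
  -- `compositions` draws its entries from 0 up to d, so each count has to be bounded by the length
  -- d.
  (∈-vectors⁺ (counts v) λ a → subst (_∈ upTo (suc d)) (sym (lookup-counts v a))
    (∈-upTo⁺ (s≤s (subst (count a (toList v) ≤_) (Vec.length-toList v) (length-filter (a ≟ᶠ_) (toList v))))))
  (begin
    Vec.sum (counts v)                              ≡⟨ sum≡∑ (counts v) ⟩
    ℕ∑.∑ (allFin n) (lookup (counts v))             ≡⟨ ℕ∑.∑-cong (allFin n) (lookup-counts v) ⟩
    ℕ∑.∑ (allFin n) (λ a → count a (toList v))      ≡⟨ ∑-count (Unique.allFin⁺ n) ∈-allFin (toList v) ⟩
    length (toList v)                               ≡⟨ Vec.length-toList v ⟩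
    d                                               ∎)

-- Ascending words and compositions correspond through `counts` and `sort`. Only matching pairs have
-- to agree, and for those the word is known to be the block list of the composition.
∑-compositions : ∀ {n} d (g : Vec ℕ n → ℚ) (g′ : Vec (Fin n) d → ℚ) →
  (∀ ds v → toList v ≡ blocks (allFin n) (lookup ds) → (∀ a → count a (toList v) ≡ lookup ds a) → g ds ≡ g′ v) →
  ℚ∑.∑ (compositions n d) g ≡ ℚ∑.∑ (words n d) (λ v → ℚ∑.𝟙 (ascending? v) * g′ v)
∑-compositions {n} d g g′ g≡g′ = sym (begin
  ℚ∑.∑ W (λ v → ℚ∑.𝟙 (ascending? v) * g′ v)
    ≡⟨ ℚ∑.∑-cong W (λ v → sym (ℚ∑.∑-𝟙-unique (counts v ≟ᵛ_) (λ _ → ℚ∑.𝟙 (ascending? v) * g′ v)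
         compositions-unique (counts-∈-compositions v) refl sym)) ⟩
  ℚ∑.∑ W (λ v → ℚ∑.∑ C (λ ds → ℚ∑.𝟙 (counts v ≟ᵛ ds) * (ℚ∑.𝟙 (ascending? v) * g′ v)))
    ≡⟨ ℚ∑.∑-swap W C _ ⟩
  ℚ∑.∑ C (λ ds → ℚ∑.∑ W (λ v → ℚ∑.𝟙 (counts v ≟ᵛ ds) * (ℚ∑.𝟙 (ascending? v) * g′ v)))
    ≡⟨ ℚ∑.∑-cong-∈ C perComposition ⟩
  ℚ∑.∑ C g ∎)
  where
  W = words n d
  C = compositions n d
  _≟ᵛ_ = Vec.≡-dec ℕ._≟_
  compositions-unique : Unique C
  compositions-unique = Unique.filter⁺ (λ ds → Vec.sum ds ℕ.≟ d) (vectors-unique n (Unique.upTo⁺ (suc d)))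

  perComposition : ∀ {ds} → ds ∈ C → ℚ∑.∑ W (λ v → ℚ∑.𝟙 (counts v ≟ᵛ ds) * (ℚ∑.𝟙 (ascending? v) * g′ v)) ≡ g ds
  perComposition {ds} ds∈
    with sort (lookup ds) (trans (sym (sum≡∑ ds))
           (proj₂ (∈-filter⁻ (λ ds → Vec.sum ds ℕ.≟ d) {xs = vectors (upTo (suc d)) n} ds∈)))
  ... | v₀ , eq , asc , same = begin
    ℚ∑.∑ W (λ v → ℚ∑.𝟙 (counts v ≟ᵛ ds) * (ℚ∑.𝟙 (ascending? v) * g′ v))
      ≡⟨ ℚ∑.∑-cong W (λ v → trans (sym (ℚ.*-assoc (ℚ∑.𝟙 (counts v ≟ᵛ ds)) (ℚ∑.𝟙 (ascending? v)) (g′ v)))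
           (cong (_* g′ v) (sym (ℚ∑.𝟙-× (counts v ≟ᵛ ds) (ascending? v))))) ⟩
    ℚ∑.∑ W (λ v → ℚ∑.𝟙 ((counts v ≟ᵛ ds) ×-dec ascending? v) * g′ v)
      ≡⟨ ℚ∑.∑-𝟙-unique (λ v → (counts v ≟ᵛ ds) ×-dec ascending? v) g′
           (vectors-unique d (Unique.allFin⁺ n)) (∈-vectors ∈-allFin v₀)
           (trans (Vec.tabulate-cong same) (Vec.tabulate∘lookup ds) , asc)
           (λ {v} (c≡ds , asc′) → ascending-unique asc′ asc
             (λ a → trans (trans (sym (lookup-counts v a)) (cong (λ c → lookup c a) c≡ds)) (sym (same a)))) ⟩
    g′ v₀
      ≡⟨ g≡g′ ds v₀ eq same ⟨
    g ds ∎

length-arcsOfWalk : ∀ {n k} (w : Vec (Fin n) (suc k)) → length (arcsOfWalk w) ≡ k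
length-arcsOfWalk (v ∷ [])     = refl
length-arcsOfWalk (u ∷ v ∷ vs) = cong suc (length-arcsOfWalk (v ∷ vs))

-- Compare total degrees: the multiplicities of a multi-digraph add up to its number of arcs, so the
-- exponents of e add up to 0.
degree-forces-𝟎 : ∀ {n} (e : Monomial n) (A D : MultiDigraph n) → length A ≡ length D →
                  monomial A ≗ᴹ e ⊕ D → e ≗ᴹ 𝟎
degree-forces-𝟎 {n} e A D len eq u v = ∑≡0⇒≡0 (λ (u , v) → e u v) total (∈-arcs (u , v))
  where
  total : ℕ∑.∑ (arcs n) (λ (u , v) → e u v) ≡ 0
  total = ℕ.+-cancelʳ-≡ (length D) _ 0 (begin
    ℕ∑.∑ (arcs n) (λ (u , v) → e u v) ℕ.+ length D
      ≡⟨ cong (ℕ∑.∑ (arcs n) (λ (u , v) → e u v) ℕ.+_) (Arcs.∑-count (arcs-unique n) ∈-arcs D) ⟨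
    ℕ∑.∑ (arcs n) (λ (u , v) → e u v) ℕ.+ ℕ∑.∑ (arcs n) (ω D)
      ≡⟨ ℕ∑.∑-+ (arcs n) (λ (u , v) → e u v) (ω D) ⟨
    ℕ∑.∑ (arcs n) (λ (u , v) → (e ⊕ D) u v)
      ≡⟨ ℕ∑.∑-cong (arcs n) (λ (u , v) → eq u v) ⟨
    ℕ∑.∑ (arcs n) (ω A)
      ≡⟨ Arcs.∑-count (arcs-unique n) ∈-arcs A ⟩
    length A
      ≡⟨ len ⟩
    length D ∎)

closedWalks : ∀ {n} → MultiDigraph n → Fin n → ℚ
closedWalks D j = fromℕ (length (eulerianClosedWalksAt D j))

-- Vertex sequences include their start, whereas `pairing-var^ᴹ` lists only the later vertices;
-- fixing the start at j reconciles the two.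
closedWalks≡∑ : ∀ {n} (D : MultiDigraph n) j →
  closedWalks D j ≡ ℚ∑.∑ (words n (length D)) (λ w → ℚ∑.𝟙 (isEulerianClosedWalk? D (j ∷ w)))
closedWalks≡∑ {n} D j = begin
  fromℕ (length (filter at-j? (words n (suc L))))
    ≡⟨ cong fromℕ (length-filter≡∑ at-j? (words n (suc L))) ⟩
  fromℕ (ℕ∑.∑ (words n (suc L)) (λ w → ℕ∑.𝟙 (at-j? w)))
    ≡⟨ fromℕ-∑-𝟙 at-j? (words n (suc L)) ⟩
  ℚ∑.∑ (words n (suc L)) (λ w → ℚ∑.𝟙 (at-j? w))
    ≡⟨ ℚ∑.∑-cartesianProductWith _∷_ (allFin n) (words n L) (λ w → ℚ∑.𝟙 (at-j? w)) ⟩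
  ℚ∑.∑ (allFin n) (λ u → ℚ∑.∑ (words n L) (λ w → ℚ∑.𝟙 (at-j? (u ∷ w))))
    ≡⟨ ℚ∑.∑-cong (allFin n) (λ u → trans
         (ℚ∑.∑-cong (words n L) (λ w → trans (ℚ∑.𝟙-× (isEulerianClosedWalk? D (u ∷ w)) (u ≟ᶠ j)) (ℚ.*-comm _ (ℚ∑.𝟙 (u ≟ᶠ j)))))
         (sym (ℚ∑.*-distribˡ-∑ (ℚ∑.𝟙 (u ≟ᶠ j)) (words n L) _))) ⟩
  ℚ∑.∑ (allFin n) (λ u → ℚ∑.𝟙 (u ≟ᶠ j) * ℚ∑.∑ (words n L) (λ w → ℚ∑.𝟙 (isEulerianClosedWalk? D (u ∷ w))))
    ≡⟨ ℚ∑.∑-𝟙-unique (_≟ᶠ j) (λ u → ℚ∑.∑ (words n L) (λ w → ℚ∑.𝟙 (isEulerianClosedWalk? D (u ∷ w))))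
         (Unique.allFin⁺ n) (∈-allFin j) refl id ⟩
  ℚ∑.∑ (words n L) (λ w → ℚ∑.𝟙 (isEulerianClosedWalk? D (j ∷ w))) ∎
  where
  L = length D
  at-j? : (w : VertexSequence D) → Dec (IsEulerianClosedWalk D w × Vec.head w ≡ j)
  at-j? w = isEulerianClosedWalk? D w ×-dec (Vec.head w ≟ᶠ j)

scaledCoeff-var^ᴹ : ∀ {n} L (j : Fin n) e (D : MultiDigraph n) → length D ≡ L →
  scaledCoeff ((var ^ᴹ L) j j) (e ⊕ D) ≡ ℚ∑.𝟙 (𝟎 ≟ᴹ e) * (fromℕ (∏ω! D) * closedWalks D j)
scaledCoeff-var^ᴹ {n} L j e D refl = begin
  scaledCoeff ((var ^ᴹ L) j j) (e ⊕ D)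
    ≡⟨ pairing-var^ᴹ L j j (δ (e ⊕ D)) (δ-cong (λ _ _ → refl)) ⟩
  ℚ∑.∑ (words n L) (λ w → ℚ∑.𝟙 (Vec.last (j ∷ w) ≟ᶠ j) * δ (e ⊕ D) (monomial (arcsOfWalk (j ∷ w))))
    ≡⟨ ℚ∑.∑-cong (words n L) perWalk ⟩
  ℚ∑.∑ (words n L) (λ w → z * (∏ω * ℚ∑.𝟙 (isEulerianClosedWalk? D (j ∷ w))))
    ≡⟨ trans (sym (ℚ∑.*-distribˡ-∑ z (words n L) _)) (cong (z *_) (sym (ℚ∑.*-distribˡ-∑ ∏ω (words n L) _))) ⟩
  z * (∏ω * ℚ∑.∑ (words n L) (λ w → ℚ∑.𝟙 (isEulerianClosedWalk? D (j ∷ w))))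
    ≡⟨ cong (λ x → z * (∏ω * x)) (closedWalks≡∑ D j) ⟨
  z * (∏ω * closedWalks D j) ∎
  where
  z = ℚ∑.𝟙 (𝟎 ≟ᴹ e)
  ∏ω = fromℕ (∏ω! D)

  perWalk : ∀ w → ℚ∑.𝟙 (Vec.last (j ∷ w) ≟ᶠ j) * δ (e ⊕ D) (monomial (arcsOfWalk (j ∷ w))) ≡
                  z * (∏ω * ℚ∑.𝟙 (isEulerianClosedWalk? D (j ∷ w)))
  perWalk w = begin
    l * (ℚ∑.𝟙 (A ≟ᴹ (e ⊕ D)) * fromℕ ((e ⊕ D) !ᴹ))
      ≡⟨ ℚ.*-assoc l (ℚ∑.𝟙 (A ≟ᴹ (e ⊕ D))) _ ⟨
    (l * ℚ∑.𝟙 (A ≟ᴹ (e ⊕ D))) * fromℕ ((e ⊕ D) !ᴹ)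
      ≡⟨ cong (_* fromℕ ((e ⊕ D) !ᴹ)) (trans (sym (ℚ∑.𝟙-× (Vec.last (j ∷ w) ≟ᶠ j) (A ≟ᴹ (e ⊕ D))))
           -- A walk with `length D` steps can have the arc multiset e ⊕ D only if e vanishes, and
           -- then it is an Eulerian closed walk of D.
           (trans (ℚ∑.𝟙-⇔ ((Vec.last (j ∷ w) ≟ᶠ j) ×-dec (A ≟ᴹ (e ⊕ D)))
                          ((𝟎 ≟ᴹ e) ×-dec isEulerianClosedWalk? D (j ∷ w)) to from)
                  (ℚ∑.𝟙-× (𝟎 ≟ᴹ e) (isEulerianClosedWalk? D (j ∷ w))))) ⟩
    (z * i) * fromℕ ((e ⊕ D) !ᴹ)
      ≡⟨ ℚ.*-assoc z i _ ⟩
    z * (i * fromℕ ((e ⊕ D) !ᴹ))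
      -- With e zero, the factorial of e ⊕ D is the product of the factorials of the arc
      -- multiplicities.
      ≡⟨ ℚ∑.𝟙-cong (𝟎 ≟ᴹ e) (λ eq → trans (cong (λ x → i * fromℕ x)
           (!ᴹ-cong {e = e ⊕ D} {monomial D} (⊕-congˡ D (λ u v → sym (eq u v))))) (ℚ.*-comm i ∏ω)) ⟩
    z * (∏ω * i) ∎
    where
    l = ℚ∑.𝟙 (Vec.last (j ∷ w) ≟ᶠ j)
    i = ℚ∑.𝟙 (isEulerianClosedWalk? D (j ∷ w))
    A = monomial (arcsOfWalk (j ∷ w))
    to : Vec.last (j ∷ w) ≡ j × A ≗ᴹ e ⊕ D → 𝟎 ≗ᴹ e × IsEulerianClosedWalk D (j ∷ w)
    to (closed , eq) = (λ u v → sym (e≗𝟎 u v)) , sym closed , λ u v → trans (eq u v) (cong (ℕ._+ ω D (u , v)) (e≗𝟎 u v))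
      where
      e≗𝟎 = degree-forces-𝟎 e (arcsOfWalk (j ∷ w)) D (length-arcsOfWalk (j ∷ w)) eq
    from : 𝟎 ≗ᴹ e × IsEulerianClosedWalk D (j ∷ w) → Vec.last (j ∷ w) ≡ j × A ≗ᴹ e ⊕ D
    from (𝟎≗e , closed , eq) = sym closed , λ u v → trans (eq u v) (cong (ℕ._+ ω D (u , v)) (𝟎≗e u v))

coeff-const : ∀ {n} q (e : Monomial n) → coeff (const q) e ≡ ℚ∑.𝟙 (𝟎 ≟ᴹ e) * q
coeff-const q e = trans (ℚ.+-identityʳ _) (if≡𝟙* (𝟎 ≟ᴹ e) q)

product-ones : ∀ {A : Set} (xs : List A) {f : A → ℕ} → (∀ x → f x ≡ 1) → product (map f xs) ≡ 1
product-ones []       f≡1 = refl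
product-ones (x ∷ xs) f≡1 = cong₂ ℕ._*_ (f≡1 x) (product-ones xs f≡1)

!ᴹ-nonZero : ∀ {n} (e : Monomial n) → NonZero (e !ᴹ)
!ᴹ-nonZero {n} e = product≢0 (All.map⁺ (All.universal (λ (u , v) → e u v ℕ.!≢0) (arcs n)))

-- Scaled coefficients determine the coefficients because e ! is nonzero; at the zero monomial e !
-- is 1, so the constant itself is not rescaled.
≈const : ∀ {n} (p : Polynomial n) q → (∀ e → scaledCoeff p e ≡ ℚ∑.𝟙 (𝟎 ≟ᴹ e) * q) → p ≈ const q
≈const {n} p q eq e = fromℕ-*-cancelʳ (e !ᴹ) {{ !ᴹ-nonZero e }} (begin
  coeff p e * fromℕ (e !ᴹ)             ≡⟨ scaledCoeff≡coeff p e ⟨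
  scaledCoeff p e                      ≡⟨ eq e ⟩
  ℚ∑.𝟙 (𝟎 ≟ᴹ e) * q                    ≡⟨ ℚ∑.𝟙-cong (𝟎 ≟ᴹ e) (λ 𝟎≗e → begin
      q                    ≡⟨ ℚ.*-identityʳ q ⟨
      q * fromℕ 1          ≡⟨ cong (λ k → q * fromℕ k) (trans (sym (!ᴹ-cong 𝟎≗e)) (product-ones (arcs n) (λ _ → refl))) ⟨
      q * fromℕ (e !ᴹ)     ∎) ⟩
  ℚ∑.𝟙 (𝟎 ≟ᴹ e) * (q * fromℕ (e !ᴹ))   ≡⟨ ℚ.*-assoc (ℚ∑.𝟙 (𝟎 ≟ᴹ e)) q _ ⟨
  (ℚ∑.𝟙 (𝟎 ≟ᴹ e) * q) * fromℕ (e !ᴹ)   ≡⟨ cong (_* fromℕ (e !ᴹ)) (coeff-const q e) ⟨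
  coeff (const q) e * fromℕ (e !ᴹ)     ∎)

-- Outdegrees and the ratio b(F) / c(F)

outdegree-++ : ∀ {n} (C D : MultiDigraph n) u → outdegree (C ++ D) u ≡ outdegree C u ℕ.+ outdegree D u
outdegree-++ C D u = trans (cong length (filter-++ (λ a → u ≟ᶠ proj₁ a) C D)) (length-++ (filter (λ a → u ≟ᶠ proj₁ a) C))

outdegree-star : ∀ {n k} i (α : Vec (Fin n) k) u → outdegree (star i α) u ≡ ℕ∑.𝟙 (u ≟ᶠ i) ℕ.* k
outdegree-star {k = k} i α u with u ≟ᶠ i
... | yes refl = begin
  outdegree (star u α) u      ≡⟨ cong length (filter-all (λ a → u ≟ᶠ proj₁ a) (All.map⁺ (All.universal (λ _ → refl) (toList α)))) ⟩
  length (star u α)           ≡⟨ trans (length-map (u ,_) (toList α)) (Vec.length-toList α) ⟩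
  k                           ≡⟨ ℕ.*-identityˡ k ⟨
  1 ℕ.* k                     ∎
... | no u≢i   = cong length (filter-none (λ a → u ≟ᶠ proj₁ a) (All.map⁺ (All.universal (λ _ → u≢i) (toList α))))

module _ {n : ℕ} (m : ℕ) where

  -- Each occurrence of u as an index emits one arc per letter of its word, hence m - 1 arcs. This
  -- is how the factorials in the definition of μ become outdegree factorials.
  outdegree-multiDigraph : ∀ {d} (F : Sequence n m d) u →
    outdegree (multiDigraph m F) u ≡ count u (toList (Vec.map proj₁ F)) ℕ.* (m ∸ 1)
  outdegree-multiDigraph []            u = refl
  outdegree-multiDigraph ((i , α) ∷ F) u = begin
    outdegree (star i α ++ multiDigraph m F) u
      ≡⟨ outdegree-++ (star i α) (multiDigraph m F) u ⟩
    outdegree (star i α) u ℕ.+ outdegree (multiDigraph m F) u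
      ≡⟨ cong₂ ℕ._+_ (outdegree-star i α u) (outdegree-multiDigraph F u) ⟩
    ℕ∑.𝟙 (u ≟ᶠ i) ℕ.* (m ∸ 1) ℕ.+ count u (toList (Vec.map proj₁ F)) ℕ.* (m ∸ 1)
      ≡⟨ ℕ.*-distribʳ-+ (m ∸ 1) (ℕ∑.𝟙 (u ≟ᶠ i)) _ ⟨
    (ℕ∑.𝟙 (u ≟ᶠ i) ℕ.+ count u (toList (Vec.map proj₁ F))) ℕ.* (m ∸ 1)
      ≡⟨ cong (ℕ._* (m ∸ 1)) (count-∷ u i (toList (Vec.map proj₁ F))) ⟨
    count u (i ∷ toList (Vec.map proj₁ F)) ℕ.* (m ∸ 1) ∎

  length-multiDigraph : ∀ {d} (F : Sequence n m d) → length (multiDigraph m F) ≡ d ℕ.* (m ∸ 1)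
  length-multiDigraph []            = refl
  length-multiDigraph ((i , α) ∷ F) = trans (length-++ (star i α))
    (cong₂ ℕ._+_ (trans (length-map (i ,_) (toList α)) (Vec.length-toList α)) (length-multiDigraph F))

ω>0⇒hasVertex : ∀ {n} (D : MultiDigraph n) {u v} → 0 < ω D (u , v) → HasVertex D u
ω>0⇒hasVertex D ω>0 = Any.map (λ { refl → inj₁ refl }) (Arcs.count>0⇒∈ D ω>0)

module _ {n m : ℕ} (H : UniformHypergraph n m) where
  open UniformHypergraph H

  indexCount : ∀ {d} → Sequence n m d → Fin n → ℕ
  indexCount F a = count a (toList (Vec.map proj₁ F))

  weight-cong : ∀ {c c′} → (∀ i → c i ≡ c′ i) → ∀ is → weight H c is ≡ weight H c′ is
  weight-cong c≗c′ []       = refl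
  weight-cong c≗c′ (i ∷ is) = cong₂ _*_ (cong (λ k → 1/ (k ℕ.* (m ∸ 1)) !) (c≗c′ i)) (weight-cong c≗c′ is)

  weight-* : ∀ c is → weight H c is * fromℕ (product (map (λ i → (c i ℕ.* (m ∸ 1)) !) is)) ≡ 1ℚ
  weight-* c []       = refl
  weight-* c (i ∷ is) = begin
    (x * w) * fromℕ (k ℕ.* P)           ≡⟨ cong ((x * w) *_) (fromℕ-homo-* k P) ⟩
    (x * w) * (fromℕ k * fromℕ P)       ≡⟨ ℚ.*-assoc x w _ ⟩
    x * (w * (fromℕ k * fromℕ P))       ≡⟨ cong (x *_) (ℚ∑.*-leftSwap w (fromℕ k) (fromℕ P)) ⟩
    x * (fromℕ k * (w * fromℕ P))       ≡⟨ ℚ.*-assoc x (fromℕ k) _ ⟨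
    (x * fromℕ k) * (w * fromℕ P)       ≡⟨ cong₂ _*_ (/-* 1 k {{(c i ℕ.* (m ∸ 1)) ℕ.!≢0}}) (weight-* c is) ⟩
    1ℚ                                  ∎
    where
    x = 1/ (c i ℕ.* (m ∸ 1)) !
    w = weight H c is
    k = (c i ℕ.* (m ∸ 1)) !
    P = product (map (λ i → (c i ℕ.* (m ∸ 1)) !) is)

  -- After multiplication by c(F), the outdegree formula makes the weight cancel against c(F) by
  -- `weight-*`.
  b/c≡ : ∀ {d} (F : Sequence n m d) → _b/c H F ≡ fromℕ (b H F) * weight H (indexCount F) (allFin n)
  b/c≡ F = fromℕ-*-cancelʳ (c H F) {{∏outdegree!≢0 (multiDigraph m F)}} (begin
    _b/c H F * fromℕ (c H F)
      ≡⟨ /-* (b H F) (c H F) {{∏outdegree!≢0 (multiDigraph m F)}} ⟩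
    fromℕ (b H F)
      ≡⟨ ℚ.*-identityʳ (fromℕ (b H F)) ⟨
    fromℕ (b H F) * 1ℚ
      ≡⟨ cong (fromℕ (b H F) *_) (weight-* (indexCount F) (allFin n)) ⟨
    fromℕ (b H F) * (w * fromℕ (product (map (λ i → (indexCount F i ℕ.* (m ∸ 1)) !) (allFin n))))
      ≡⟨ cong (λ k → fromℕ (b H F) * (w * fromℕ k))
           (product-cong (allFin n) (λ u → cong _! (outdegree-multiDigraph m F u))) ⟨
    fromℕ (b H F) * (w * fromℕ (c H F))
      ≡⟨ ℚ.*-assoc (fromℕ (b H F)) w _ ⟨
    (fromℕ (b H F) * w) * fromℕ (c H F) ∎)
    where
    w = weight H (indexCount F) (allFin n)

  scale : ℚ
  scale = fromℕ ((m ∸ 1) ^ (n ∸ 1))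

  walkTerm : ∀ {d} → Fin n → Sequence n m d → ℚ
  walkTerm j F = _b/c H F * fromℕ (∣W⟨_,_⟩∣ H F j)

  -- Without the conditions that D(F) is Eulerian and contains j, which only
  -- discard sequences F with W(F, j) empty.
  fullWalkSum : ℕ → Fin n → ℚ
  fullWalkSum d j = scale * ℚ∑.∑ (sequences n m d)
    (λ F → (ℚ∑.𝟙 (ascending? (Vec.map proj₁ F)) * ℚ∑.𝟙 (allGood? H F)) * walkTerm j F)

  scaledCoeff-μ : ∀ d j e → scaledCoeff (μ H d j) e ≡ ℚ∑.𝟙 (𝟎 ≟ᴹ e) * fullWalkSum d j
  scaledCoeff-μ d j e = begin
    scaledCoeff (μ H d j) e
      ≡⟨ pairing-· scale (sumᴾ (map summand (compositions n d))) (δ e) ⟩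
    scale * scaledCoeff (sumᴾ (map summand (compositions n d))) e
      ≡⟨ cong (scale *_) (begin
        scaledCoeff (sumᴾ (map summand (compositions n d))) e
          ≡⟨ pairing-sumᴾ summand (compositions n d) (δ e) ⟩
        ℚ∑.∑ (compositions n d) (λ ds → scaledCoeff (summand ds) e)
          ≡⟨ ℚ∑.∑-cong (compositions n d) (λ ds → scaledCoeff-summand H (lookup ds) p (allFin n) e) ⟩
        ℚ∑.∑ (compositions n d) (λ ds → weight H (lookup ds) (allFin n) * shiftSums H f (blocks (allFin n) (lookup ds)) e)
          -- The sum over d₁ + ⋯ + dₙ = d becomes a sum over ascending index words, whose letter
          -- counts are the dᵢ.
          ≡⟨ ∑-compositions d _ (λ v → w v * shiftSums H f (toList v) e) (λ ds v eq same →
               cong₂ _*_ (weight-cong (sym ∘ same) (allFin n)) (cong (λ is → shiftSums H f is e) (sym eq))) ⟩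
        ℚ∑.∑ (words n d) (λ v → A v * (w v * shiftSums H f (toList v) e))
          ≡⟨ ℚ∑.∑-cong (words n d) (λ v → sym (ℚ.*-assoc (A v) (w v) _)) ⟩
        ℚ∑.∑ (words n d) (λ v → (A v * w v) * shiftSums H f (toList v) e)
          ≡⟨ ∑-sequences H d (λ v → A v * w v) f (scaledCoeff-cong p) e ⟨
        ℚ∑.∑ (sequences n m d) (λ F → (A (is F) * w (is F)) * (g F * f (e ⊕ multiDigraph m F)))
          ≡⟨ ℚ∑.∑-cong (sequences n m d) perSequence ⟩
        ℚ∑.∑ (sequences n m d) (λ F → z * ((A (is F) * g F) * walkTerm j F))
          ≡⟨ ℚ∑.*-distribˡ-∑ z (sequences n m d) _ ⟨
        z * ℚ∑.∑ (sequences n m d) (λ F → (A (is F) * g F) * walkTerm j F) ∎) ⟩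
    scale * (z * ℚ∑.∑ (sequences n m d) (λ F → (A (is F) * g F) * walkTerm j F))
      ≡⟨ ℚ∑.*-leftSwap scale z _ ⟩
    z * fullWalkSum d j ∎
    where
    p = (var ^ᴹ (d ℕ.* (m ∸ 1))) j j
    f = scaledCoeff p
    z = ℚ∑.𝟙 (𝟎 ≟ᴹ e)
    is : Sequence n m d → Vec (Fin n) d
    is = Vec.map proj₁
    A : Vec (Fin n) d → ℚ
    A v = ℚ∑.𝟙 (ascending? v)
    w : Vec (Fin n) d → ℚ
    w v = weight H (λ a → count a (toList v)) (allFin n)
    g : Sequence n m d → ℚ
    g F = ℚ∑.𝟙 (allGood? H F)
    -- Restates the local function of `μ`, with which it agrees by unfolding, so that it can be
    -- named here.
    summand : Vec ℕ n → Polynomial n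
    summand ds = foldr (λ i p → 1/ (lookup ds i ℕ.* (m ∸ 1)) ! · fold p (tensorDerivative H i) (lookup ds i)) p (allFin n)

    perSequence : ∀ F → (A (is F) * w (is F)) * (g F * f (e ⊕ multiDigraph m F)) ≡ z * ((A (is F) * g F) * walkTerm j F)
    perSequence F = begin
      (x * y) * (g F * f (e ⊕ multiDigraph m F))
        ≡⟨ cong (λ r → (x * y) * (g F * r)) (scaledCoeff-var^ᴹ (d ℕ.* (m ∸ 1)) j e (multiDigraph m F) (length-multiDigraph m F)) ⟩
      (x * y) * (g F * (z * (β * W)))
        ≡⟨ rearrange x y (g F) z β W ⟩
      z * ((x * g F) * ((β * y) * W))
        ≡⟨ cong (λ r → z * ((x * g F) * (r * W))) (b/c≡ F) ⟨
      z * ((x * g F) * walkTerm j F) ∎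
      where
      x = A (is F)
      y = w (is F)
      β = fromℕ (b H F)
      W = closedWalks (multiDigraph m F) j
      open +-*-Solver using (solve; _:*_; _:=_)
      rearrange : ∀ x y g z β W → (x * y) * (g * (z * (β * W))) ≡ z * ((x * g) * ((β * y) * W))
      rearrange = solve 6 (λ x y g z β W → (x :* y) :* (g :* (z :* (β :* W))) := z :* ((x :* g) :* ((β :* y) :* W))) refl

  μ≈fullWalkSum : ∀ d j → μ H d j ≈ const (fullWalkSum d j)
  μ≈fullWalkSum d j = ≈const (μ H d j) (fullWalkSum d j) (scaledCoeff-μ d j)

  -- The empty sequence contributes 1: the one-vertex walk at j is an Eulerian closed walk of the
  -- empty digraph. A sum over `ℱ` would miss it, as the empty digraph has no vertices.
  fullWalkSum-zero : ∀ j → fullWalkSum 0 j ≡ scale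
  fullWalkSum-zero j = begin
    scale * ((1ℚ * 1ℚ) * walkTerm j [] + 0ℚ)
      ≡⟨ cong (λ t → scale * ((1ℚ * 1ℚ) * t + 0ℚ)) walkTerm-[] ⟩
    scale * 1ℚ
      ≡⟨ ℚ.*-identityʳ scale ⟩
    scale ∎
    where
    weight-𝟎 : ∀ is → weight H (λ _ → 0) is ≡ 1ℚ
    weight-𝟎 []       = refl
    weight-𝟎 (i ∷ is) = trans (ℚ.*-identityˡ _) (weight-𝟎 is)

    walkTerm-[] : walkTerm {0} j [] ≡ 1ℚ
    walkTerm-[] = begin
      _b/c H [] * closedWalks [] j
        ≡⟨ cong₂ _*_ (trans (b/c≡ []) (cong₂ (λ k w → fromℕ k * w) (product-ones (arcs n) (λ _ → refl)) (weight-𝟎 (allFin n))))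
                     (trans (closedWalks≡∑ [] j) (cong (_+ 0ℚ)
                       (ℚ∑.𝟙-yes (isEulerianClosedWalk? [] (j ∷ [])) (refl , λ _ _ → refl)))) ⟩
      1ℚ ∎

  fullWalkSum-suc : ∀ d j → fullWalkSum (suc d) j ≡ walkSum H (suc d) j
  fullWalkSum-suc d j = cong (scale *_) (begin
    ℚ∑.∑ (sequences n m (suc d)) (λ F → (A F * g F) * walkTerm j F)
      ≡⟨ ℚ∑.∑-cong (sequences n m (suc d)) perSequence ⟩
    ℚ∑.∑ (sequences n m (suc d)) (λ F → ℚ∑.𝟙 (_∈ℱ⟨_⟩? H F j) * walkTerm j F)
      ≡⟨ ℚ∑.∑-filter (λ F → _∈ℱ⟨_⟩? H F j) (sequences n m (suc d)) (walkTerm j) ⟨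
    ℚ∑.∑ (ℱ H (suc d) j) (walkTerm j) ∎)
    where
    A g : Sequence n m (suc d) → ℚ
    A F = ℚ∑.𝟙 (ascending? (Vec.map proj₁ F))
    g F = ℚ∑.𝟙 (allGood? H F)

    -- With d + 1 components and m ≥ 2 there is at least one arc, so a walk has a first step, and
    -- that arc of D(F) leaves its start j.
    nonempty : ∀ F {w} → IsEulerianClosedWalk (multiDigraph m F) w → Vec.head w ≡ j → HasVertex (multiDigraph m F) j
    nonempty F {w} (_ , same) at-j = subst (HasVertex (multiDigraph m F)) at-j (go (multiDigraph m F) w same positive)
      where
      positive : 0 < length (multiDigraph m F)
      positive = subst (0 ℕ.<_) (sym (length-multiDigraph m F))
        (ℕ.*-mono-≤ {1} {suc d} {1} (s≤s z≤n) (ℕ.∸-monoˡ-≤ 1 2≤m))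
      go : ∀ D (w : VertexSequence D) → (∀ u v → ω (arcsOfWalk w) (u , v) ≡ ω D (u , v)) →
           0 < length D → HasVertex D (Vec.head w)
      go D@(_ ∷ _) (u ∷ v ∷ w) same _ = ω>0⇒hasVertex D {u} {v}
        (subst (0 ℕ.<_) (same u v) (Arcs.∈⇒count>0 {xs = (u , v) ∷ arcsOfWalk (v ∷ w)} (here refl)))

    -- If there is no walk at j, both sides are 0; any walk at j witnesses at once that D(F) is
    -- Eulerian and that it contains j.
    redundant : ∀ F → walkTerm j F ≡ ℚ∑.𝟙 (eulerian? (multiDigraph m F) ×-dec hasVertex? (multiDigraph m F) j) * walkTerm j F
    redundant F = go (eulerianClosedWalksAt D j) refl
      where
      D = multiDigraph m F
      R? = eulerian? D ×-dec hasVertex? D j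
      go : ∀ ws → eulerianClosedWalksAt D j ≡ ws → walkTerm j F ≡ ℚ∑.𝟙 R? * walkTerm j F
      go [] eq = trans t≡0 (sym (trans (cong (ℚ∑.𝟙 R? *_) t≡0) (ℚ.*-zeroʳ (ℚ∑.𝟙 R?))))
        where
        t≡0 : walkTerm j F ≡ 0ℚ
        t≡0 = trans (cong (λ ws → _b/c H F * fromℕ (length ws)) eq) (ℚ.*-zeroʳ (_b/c H F))
      go (w ∷ _) eq = sym (trans
        (cong (_* walkTerm j F) (ℚ∑.𝟙-yes R? ((w , proj₁ found) , nonempty F {w} (proj₁ found) (proj₂ found))))
        (ℚ.*-identityˡ (walkTerm j F)))
        where
        found : IsEulerianClosedWalk D w × Vec.head w ≡ j
        found = proj₂ (∈-filter⁻ (λ w → isEulerianClosedWalk? D w ×-dec (Vec.head w ≟ᶠ j))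
                         {xs = words n (suc (length D))} (subst (w ∈_) (sym eq) (here refl)))

    perSequence : ∀ F → (A F * g F) * walkTerm j F ≡ ℚ∑.𝟙 (_∈ℱ⟨_⟩? H F j) * walkTerm j F
    perSequence F = begin
      (A F * g F) * walkTerm j F
        ≡⟨ cong ((A F * g F) *_) (redundant F) ⟩
      (A F * g F) * (R * walkTerm j F)
        ≡⟨ ℚ.*-assoc (A F * g F) R (walkTerm j F) ⟨
      ((A F * g F) * R) * walkTerm j F
        ≡⟨ cong (_* walkTerm j F) (trans (ℚ.*-assoc (A F) (g F) R)
             (trans (cong (A F *_) (sym (ℚ∑.𝟙-× (allGood? H F) R?)))
                    (sym (ℚ∑.𝟙-× (ascending? (Vec.map proj₁ F)) (allGood? H F ×-dec R?))))) ⟩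
      ℚ∑.𝟙 (_∈ℱ⟨_⟩? H F j) * walkTerm j F ∎
      where
      R? = eulerian? (multiDigraph m F) ×-dec hasVertex? (multiDigraph m F) j
      R = ℚ∑.𝟙 R?

  fullWalkSum≡closedForm : ∀ d j → fullWalkSum d j ≡ closedForm H d j
  fullWalkSum≡closedForm zero    j = fullWalkSum-zero j
  fullWalkSum≡closedForm (suc d) j = fullWalkSum-suc d j

  μ≈closedForm : ∀ d j → μ H d j ≈ const (closedForm H d j)
  μ≈closedForm d j e = trans (μ≈fullWalkSum d j e) (cong (λ q → coeff (const q) e) (fullWalkSum≡closedForm d j))

-- Convergence

0≤+/ : ∀ a c .{{_ : NonZero c}} → 0ℚ ℚ.≤ ℤ.+ a / c
0≤+/ a c = ℚ.nonNegative⁻¹ (ℤ.+ a / c) {{ℚ.normalize-nonNeg a c}}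

*-mono-≤ : ∀ {p q r s} → 0ℚ ℚ.≤ q → 0ℚ ℚ.≤ r → p ℚ.≤ q → r ℚ.≤ s → p * r ℚ.≤ q * s
*-mono-≤ {p} {q} {r} {s} 0≤q 0≤r p≤q r≤s = ℚ.≤-trans
  (ℚ.*-monoʳ-≤-nonNeg r {{ℚ.nonNegative 0≤r}} p≤q)
  (ℚ.*-monoˡ-≤-nonNeg q {{ℚ.nonNegative 0≤q}} r≤s)

0≤* : ∀ {p q} → 0ℚ ℚ.≤ p → 0ℚ ℚ.≤ q → 0ℚ ℚ.≤ p * q
0≤* {p} {q} 0≤p 0≤q = subst (ℚ._≤ p * q) (ℚ.*-zeroˡ q) (ℚ.*-monoʳ-≤-nonNeg q {{ℚ.nonNegative 0≤q}} 0≤p)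

fromℕ-*-cancelʳ-≤ : ∀ c .{{_ : NonZero c}} {p q} → p * fromℕ c ℚ.≤ q * fromℕ c → p ℚ.≤ q
fromℕ-*-cancelʳ-≤ c@(suc _) = ℚ.*-cancelʳ-≤-pos (fromℕ c) {{ℚ.normalize-pos c 1}}

fromℕ-mono-< : ∀ {a b} → a < b → fromℕ a ℚ.< fromℕ b
fromℕ-mono-< {a} a<b = ℚ.<-≤-trans
  (subst₂ ℚ._<_ (ℚ.+-identityˡ (fromℕ a)) (sym (fromℕ-homo-+ 1 a)) (ℚ.+-monoˡ-< (fromℕ a) (ℚ.positive⁻¹ 1ℚ)))
  (fromℕ-mono-≤ a<b)

-- A positive rational has numerator at least 1. This is the Archimedean input for the Cauchy
-- condition.
1≤ε*↧ε : ∀ ε → 0ℚ ℚ.< ε → 1ℚ ℚ.≤ ε * fromℕ (ℚ.↧ₙ ε)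
1≤ε*↧ε ε@(ℚ.mkℚ (ℤ.+ suc k) d _) 0<ε = subst (1ℚ ℚ.≤_)
  (trans (sym (/-* (suc k) (suc d))) (cong (_* fromℕ (suc d)) (ℚ.↥p/↧p≡p ε)))
  (fromℕ-mono-≤ {1} {suc k} (s≤s z≤n))
1≤ε*↧ε (ℚ.mkℚ (ℤ.+ zero) d _)     0<ε with ℚ.drop-*<* 0<ε
... | ℤ.+<+ ()
1≤ε*↧ε (ℚ.mkℚ (ℤ.-[1+ k ]) d _) 0<ε with ℚ.drop-*<* 0<ε
... | ()

∣p-q∣≤ : ∀ {lo hi p q} → lo ℚ.≤ p → p ℚ.≤ hi → lo ℚ.≤ q → q ℚ.≤ hi → ℚ.∣ p ℚ.- q ∣ ℚ.≤ hi ℚ.- lo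
∣p-q∣≤ {lo} {hi} {p} {q} lo≤p p≤hi lo≤q q≤hi with ℚ.∣p∣≡p∨∣p∣≡-p (p ℚ.- q)
... | inj₁ eq = subst (ℚ._≤ hi ℚ.- lo) (sym eq) (ℚ.+-mono-≤ p≤hi (ℚ.neg-antimono-≤ lo≤q))
... | inj₂ eq = subst (ℚ._≤ hi ℚ.- lo) (sym (trans eq (flip p q))) (ℚ.+-mono-≤ q≤hi (ℚ.neg-antimono-≤ lo≤p))
  where
  open +-*-Solver using (solve; _:-_; _:+_; :-_; _:=_)
  flip : ∀ p q → ℚ.- (p ℚ.- q) ≡ q ℚ.- p
  flip = solve 2 (λ p q → :- (p :- q) := q :- p) refl

n<2^n : ∀ k → k < 2 ^ k
n<2^n zero    = s≤s z≤n
n<2^n (suc k) = ℕ.≤-trans (ℕ.+-mono-≤ (ℕ.≤-trans (s≤s z≤n) (n<2^n k)) (n<2^n k))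
  (ℕ.≤-reflexive (cong (2 ^ k ℕ.+_) (sym (ℕ.+-identityʳ (2 ^ k)))))

-- Series of nonnegative terms with a geometric majorant

module _ (a : ℕ → ℚ) (B : ℕ) (0≤a : ∀ d → 0ℚ ℚ.≤ a d)
         (a*2^≤B : ∀ d → a d * fromℕ (2 ^ d) ℚ.≤ fromℕ B) where

  private
    r : ℕ → ℚ
    r d = (ℤ.+ B / 2 ^ d) {{ℕ.m^n≢0 2 d}}

    r-halves : ∀ d → r d ≡ r (suc d) + r (suc d)
    r-halves d = fromℕ-*-cancelʳ (2 ^ suc d) {{ℕ.m^n≢0 2 (suc d)}} (begin
      r d * fromℕ (2 ^ suc d)
        ≡⟨ cong (r d *_) (fromℕ-homo-* 2 (2 ^ d)) ⟩
      r d * (fromℕ 2 * fromℕ (2 ^ d))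
        ≡⟨ ℚ∑.*-leftSwap (r d) (fromℕ 2) (fromℕ (2 ^ d)) ⟩
      fromℕ 2 * (r d * fromℕ (2 ^ d))
        ≡⟨ cong (fromℕ 2 *_) (trans (/-* B (2 ^ d) {{ℕ.m^n≢0 2 d}}) (sym (/-* B (2 ^ suc d) {{ℕ.m^n≢0 2 (suc d)}}))) ⟩
      fromℕ 2 * (r (suc d) * fromℕ (2 ^ suc d))
        ≡⟨ ℚ.*-assoc (fromℕ 2) (r (suc d)) _ ⟨
      (fromℕ 2 * r (suc d)) * fromℕ (2 ^ suc d)
        ≡⟨ cong (_* fromℕ (2 ^ suc d)) (double (r (suc d))) ⟩
      (r (suc d) + r (suc d)) * fromℕ (2 ^ suc d) ∎)
      where
      double : ∀ x → fromℕ 2 * x ≡ x + x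
      double x = trans (ℚ.*-distribʳ-+ x 1ℚ 1ℚ) (cong₂ _+_ (ℚ.*-identityˡ x) (ℚ.*-identityˡ x))

    a≤r : ∀ d → a d ℚ.≤ r d
    a≤r d = fromℕ-*-cancelʳ-≤ (2 ^ d) {{ℕ.m^n≢0 2 d}}
      (subst (a d * fromℕ (2 ^ d) ℚ.≤_) (sym (/-* B (2 ^ d) {{ℕ.m^n≢0 2 d}})) (a*2^≤B d))

    -- The tail B / 2^k + B / 2^(k + 1) + ⋯ equals 2 r k, so from k on the partial sums stay between
    -- `partialSum a k` and this bound.
    upper : ℕ → ℚ
    upper k = partialSum a k + (r k + r k)

    lower-step : ∀ k → partialSum a k ℚ.≤ partialSum a (suc k)
    lower-step k = subst (ℚ._≤ partialSum a k + a k) (ℚ.+-identityʳ (partialSum a k)) (ℚ.+-monoʳ-≤ (partialSum a k) (0≤a k))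

    upper-step : ∀ k → upper (suc k) ℚ.≤ upper k
    upper-step k = subst₂ ℚ._≤_
      -- Two copies of r (k + 1) make one r k, so passing to k + 1 replaces one r k by the smaller a
      -- k.
      (trans (sym (ℚ.+-assoc (partialSum a k) (a k) (r k))) (cong (λ y → (partialSum a k + a k) + y) (r-halves k)))
      refl
      (ℚ.+-monoʳ-≤ (partialSum a k) (ℚ.+-monoˡ-≤ (r k) (a≤r k)))

    lower-mono : ∀ k t → partialSum a k ℚ.≤ partialSum a (t ℕ.+ k)
    lower-mono k zero    = ℚ.≤-refl
    lower-mono k (suc t) = ℚ.≤-trans (lower-mono k t) (lower-step (t ℕ.+ k))

    upper-anti : ∀ k t → upper (t ℕ.+ k) ℚ.≤ upper k
    upper-anti k zero    = ℚ.≤-refl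
    upper-anti k (suc t) = ℚ.≤-trans (upper-step (t ℕ.+ k)) (upper-anti k t)

    ≤upper : ∀ k → partialSum a k ℚ.≤ upper k
    ≤upper k = subst (ℚ._≤ upper k) (ℚ.+-identityʳ (partialSum a k))
      (ℚ.+-monoʳ-≤ (partialSum a k) (ℚ.+-mono-≤ 0≤r 0≤r))
      where 0≤r = 0≤+/ B (2 ^ k) {{ℕ.m^n≢0 2 k}}

    r-small : ∀ ε → 0ℚ ℚ.< ε → ∃[ N ] r N + r N ℚ.< ε
    r-small ε 0<ε = N , ℚ.*-cancelʳ-<-nonNeg (fromℕ (2 ^ N)) {{ℚ.nonNegative (fromℕ-≥0 (2 ^ N))}}
      (subst (ℚ._< ε * fromℕ (2 ^ N)) (sym 2rN)
        (ℚ.≤-<-trans 2B≤εN (ℚ.*-monoʳ-<-pos ε {{ℚ.positive 0<ε}} (fromℕ-mono-< (n<2^n N)))))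
      where
      q = ℚ.↧ₙ ε
      -- With q the denominator of ε, 1 ≤ εq gives 2B ≤ εN, and N < 2^N makes the inequality 2B < ε
      -- 2^N strict.
      N = q ℕ.* (B ℕ.+ B)

      2rN : (r N + r N) * fromℕ (2 ^ N) ≡ fromℕ (B ℕ.+ B)
      2rN = begin
        (r N + r N) * fromℕ (2 ^ N)
          ≡⟨ ℚ.*-distribʳ-+ (fromℕ (2 ^ N)) (r N) (r N) ⟩
        r N * fromℕ (2 ^ N) + r N * fromℕ (2 ^ N)
          ≡⟨ cong (λ x → x + x) (/-* B (2 ^ N) {{ℕ.m^n≢0 2 N}}) ⟩
        fromℕ B + fromℕ B
          ≡⟨ fromℕ-homo-+ B B ⟨
        fromℕ (B ℕ.+ B) ∎

      2B≤εN : fromℕ (B ℕ.+ B) ℚ.≤ ε * fromℕ N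
      2B≤εN = subst₂ ℚ._≤_ (ℚ.*-identityˡ (fromℕ (B ℕ.+ B)))
        (trans (ℚ.*-assoc ε (fromℕ q) (fromℕ (B ℕ.+ B))) (cong (ε *_) (sym (fromℕ-homo-* q (B ℕ.+ B)))))
        (ℚ.*-monoʳ-≤-nonNeg (fromℕ (B ℕ.+ B)) {{ℚ.nonNegative (fromℕ-≥0 (B ℕ.+ B))}} (1≤ε*↧ε ε 0<ε))

  partialSum-cauchy : ∀ ε → 0ℚ ℚ.< ε →
    ∃[ N ] (∀ k l → N ≤ k → N ≤ l → ℚ.∣ partialSum a k ℚ.- partialSum a l ∣ ℚ.< ε)
  -- All later partial sums lie in the interval from `partialSum a N` to `upper N`, of length 2 r N
  -- < ε.
  partialSum-cauchy ε 0<ε = N , λ k l N≤k N≤l → ℚ.≤-<-trans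
    (∣p-q∣≤ (above k N≤k) (below k N≤k) (above l N≤l) (below l N≤l))
    (subst (ℚ._< ε) (sym (gap (partialSum a N) (r N + r N))) (proj₂ (r-small ε 0<ε)))
    where
    N = proj₁ (r-small ε 0<ε)
    above : ∀ k → N ≤ k → partialSum a N ℚ.≤ partialSum a k
    above k N≤k = subst (λ k → partialSum a N ℚ.≤ partialSum a k) (ℕ.m∸n+n≡m N≤k) (lower-mono N (k ∸ N))
    below : ∀ k → N ≤ k → partialSum a k ℚ.≤ upper N
    below k N≤k = ℚ.≤-trans (≤upper k) (subst (λ k → upper k ℚ.≤ upper N) (ℕ.m∸n+n≡m N≤k) (upper-anti N (k ∸ N)))
    open +-*-Solver using (solve; _:-_; _:+_; _:=_)
    gap : ∀ s t → (s + t) ℚ.- s ≡ t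
    gap = solve 2 (λ s t → (s :+ t) :- s := t) refl

-- While the exponent is at most x the power is at most x^x; afterwards each step multiplies the
-- left side by x and the right side by at least x.
x^d≤x^x*d! : ∀ x d → x ^ d ≤ x ^ x ℕ.* d !
x^d≤x^x*d! zero    zero    = ℕ.≤-refl
x^d≤x^x*d! zero    (suc d) = z≤n
x^d≤x^x*d! (suc x) zero    = ℕ.≤-trans (ℕ.m^n>0 (suc x) (suc x)) (ℕ.≤-reflexive (sym (ℕ.*-identityʳ _)))
x^d≤x^x*d! X@(suc x) (suc d) with ℕ.≤-total (suc d) X
... | inj₁ d<X = ℕ.≤-trans (ℕ.^-monoʳ-≤ X d<X) (ℕ.m≤m*n (X ^ X) (suc d !) {{ℕ._!≢0 (suc d)}})
... | inj₂ X≤d = ℕ.≤-trans (ℕ.*-mono-≤ X≤d (x^d≤x^x*d! X d))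
  (ℕ.≤-reflexive (ℕ∑.*-leftSwap (suc d) (X ^ X) (d !)))

^-distribʳ-* : ∀ d x y → (x ℕ.* y) ^ d ≡ x ^ d ℕ.* y ^ d
^-distribʳ-* zero    x y = refl
^-distribʳ-* (suc d) x y = trans (cong ((x ℕ.* y) ℕ.*_) (^-distribʳ-* d x y))
  (ℕ.[m*n]*[o*p]≡[m*o]*[n*p] x y (x ^ d) (y ^ d))

-- Bounds on the terms of the centrality series

∑-≥0 : ∀ {A : Set} (xs : List A) {f : A → ℚ} → (∀ x → 0ℚ ℚ.≤ f x) → 0ℚ ℚ.≤ ℚ∑.∑ xs f
∑-≥0 []       0≤f = ℚ.≤-refl
∑-≥0 (x ∷ xs) 0≤f = ℚ.+-mono-≤ (0≤f x) (∑-≥0 xs 0≤f)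

∑-≤ : ∀ {A : Set} (xs : List A) {f : A → ℚ} k → (∀ x → f x ℚ.≤ fromℕ k) → ℚ∑.∑ xs f ℚ.≤ fromℕ (length xs ℕ.* k)
∑-≤ []       k f≤ = ℚ.≤-refl
∑-≤ (x ∷ xs) k f≤ = subst (_ ℚ.≤_) (sym (fromℕ-homo-+ k (length xs ℕ.* k))) (ℚ.+-mono-≤ (f≤ x) (∑-≤ xs k f≤))

𝟙-≥0 : ∀ {P : Set} (P? : Dec P) → 0ℚ ℚ.≤ ℚ∑.𝟙 P?
𝟙-≥0 (true  because _) = fromℕ-≥0 1
𝟙-≥0 (false because _) = fromℕ-≥0 0

𝟙-≤1 : ∀ {P : Set} (P? : Dec P) → ℚ∑.𝟙 P? ℚ.≤ 1ℚ
𝟙-≤1 (true  because _) = ℚ.≤-refl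
𝟙-≤1 (false because _) = fromℕ-≥0 1

outdegree-∷ : ∀ {n} (x : Arc n) D u → outdegree (x ∷ D) u ≡ ℕ∑.𝟙 (u ≟ᶠ proj₁ x) ℕ.+ outdegree D u
outdegree-∷ x D u with does (u ≟ᶠ proj₁ x)
... | true  = refl
... | false = refl

ω≤outdegree : ∀ {n} (D : MultiDigraph n) a → ω D a ≤ outdegree D (proj₁ a)
ω≤outdegree []      a = z≤n
ω≤outdegree (x ∷ D) a = subst₂ _≤_ (sym (Arcs.count-∷ a x D)) (sym (outdegree-∷ x D (proj₁ a)))
  (ℕ.+-mono-≤ (𝟙-mono (a ≟ᴬ x) (proj₁ a ≟ᶠ proj₁ x) (cong proj₁)) (ω≤outdegree D a))
  where
  𝟙-mono : ∀ {P Q : Set} (P? : Dec P) (Q? : Dec Q) → (P → Q) → ℕ∑.𝟙 P? ≤ ℕ∑.𝟙 Q?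
  𝟙-mono (yes p) Q? P⇒Q = ℕ.≤-reflexive (sym (ℕ∑.𝟙-yes Q? (P⇒Q p)))
  𝟙-mono (no _)  Q? _   = z≤n

-- Adjoining an arc with tail u multiplies the left side by one more than its multiplicity and the
-- right side by one more than the outdegree of u, which is no smaller. In effect the quotient is a
-- product of multinomial coefficients.
∏ω!≤∏outdegree! : ∀ {n} (D : MultiDigraph n) → ∏ω! D ≤ ∏outdegree! D
∏ω!≤∏outdegree! {n} [] = ℕ.≤-reflexive
  (trans (product-ones (arcs n) (λ _ → refl)) (sym (product-ones (allFin n) (λ _ → refl))))
∏ω!≤∏outdegree! {n} (x@(u , v) ∷ D) = subst₂ _≤_ (sym ω-step) (sym outdegree-step)
  (ℕ.*-mono-≤ (s≤s (ω≤outdegree D x)) (∏ω!≤∏outdegree! D))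
  where
  ω-step : ∏ω! (x ∷ D) ≡ suc (ω D x) ℕ.* ∏ω! D
  ω-step = product-update (suc (ω D x)) (arcs-unique n) (∈-arcs x)
    (cong _! (Arcs.count-∷-≡ x D)) (λ y y≢x → cong _! (Arcs.count-∷-≢ D y≢x))
  outdegree-step : ∏outdegree! (x ∷ D) ≡ suc (outdegree D u) ℕ.* ∏outdegree! D
  outdegree-step = product-update (suc (outdegree D u)) (Unique.allFin⁺ n) (∈-allFin u)
    (cong _! (trans (outdegree-∷ x D u) (cong (ℕ._+ outdegree D u) (ℕ∑.𝟙-yes (u ≟ᶠ u) refl))))
    (λ y y≢u → cong _! (trans (outdegree-∷ x D y) (cong (ℕ._+ outdegree D y) (ℕ∑.𝟙-no (y ≟ᶠ u) y≢u))))

length-words : ∀ n k → length (words n k) ≡ n ^ k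
length-words n k = trans (length-vectors (allFin n) k) (cong (_^ k) (length-tabulate {n = n} id))

module _ {n m : ℕ} (H : UniformHypergraph n m) (j : Fin n) where

  b/c≥0 : ∀ {d} (F : Sequence n m d) → 0ℚ ℚ.≤ _b/c H F
  b/c≥0 F = 0≤+/ (b H F) (c H F) {{∏outdegree!≢0 (multiDigraph m F)}}

  b/c≤1 : ∀ {d} (F : Sequence n m d) → _b/c H F ℚ.≤ 1ℚ
  b/c≤1 F = fromℕ-*-cancelʳ-≤ (c H F) {{∏outdegree!≢0 (multiDigraph m F)}}
    (subst₂ ℚ._≤_ (sym (/-* (b H F) (c H F) {{∏outdegree!≢0 (multiDigraph m F)}}))
      (sym (ℚ.*-identityˡ (fromℕ (c H F)))) (fromℕ-mono-≤ (∏ω!≤∏outdegree! (multiDigraph m F))))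

  -- Counts all vertex sequences of the length of an Eulerian closed walk, start included.
  walkBound : ℕ → ℕ
  walkBound d = n ^ suc (d ℕ.* (m ∸ 1))

  ∣W∣≤walkBound : ∀ {d} (F : Sequence n m d) → ∣W⟨_,_⟩∣ H F j ≤ walkBound d
  ∣W∣≤walkBound F = ℕ.≤-trans
    (length-filter (λ w → isEulerianClosedWalk? D w ×-dec (Vec.head w ≟ᶠ j)) (words n (suc (length D))))
    (ℕ.≤-reflexive (trans (length-words n (suc (length D))) (cong (λ k → n ^ suc k) (length-multiDigraph m F))))
    where D = multiDigraph m F

  term : ∀ {d} → Sequence n m d → ℚ
  term F = (ℚ∑.𝟙 (ascending? (Vec.map proj₁ F)) * ℚ∑.𝟙 (allGood? H F)) * walkTerm H j F

  term≥0 : ∀ {d} (F : Sequence n m d) → 0ℚ ℚ.≤ term F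
  term≥0 F = 0≤* (0≤* (𝟙-≥0 (ascending? (Vec.map proj₁ F))) (𝟙-≥0 (allGood? H F)))
                 (0≤* (b/c≥0 F) (fromℕ-≥0 (∣W⟨_,_⟩∣ H F j)))

  term≤walkBound : ∀ {d} (F : Sequence n m d) → term F ℚ.≤ fromℕ (walkBound d)
  term≤walkBound {d} F = subst (term F ℚ.≤_)
    (trans (cong₂ _*_ (ℚ.*-identityˡ 1ℚ) (ℚ.*-identityˡ (fromℕ (walkBound d)))) (ℚ.*-identityˡ (fromℕ (walkBound d))))
    (*-mono-≤ {q = 1ℚ * 1ℚ} {s = 1ℚ * fromℕ (walkBound d)}
      (fromℕ-≥0 1) (0≤* (b/c≥0 F) (fromℕ-≥0 (∣W⟨_,_⟩∣ H F j)))
      (*-mono-≤ {q = 1ℚ} {s = 1ℚ} (fromℕ-≥0 1) (𝟙-≥0 (allGood? H F)) (𝟙-≤1 (ascending? (Vec.map proj₁ F))) (𝟙-≤1 (allGood? H F)))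
      (*-mono-≤ {q = 1ℚ} {s = fromℕ (walkBound d)} (fromℕ-≥0 1) (fromℕ-≥0 (∣W⟨_,_⟩∣ H F j)) (b/c≤1 F) (fromℕ-mono-≤ (∣W∣≤walkBound F))))

  -- `V` is the prefactor of μ. `K` counts the choices per component of F: n · n^(m - 1) for the
  -- component iα and n^(m - 1) for the corresponding m - 1 steps of a walk. The start of the walk
  -- gives the extra factor n in `closedForm≤`.
  V K : ℕ
  V = (m ∸ 1) ^ (n ∸ 1)
  K = (n ℕ.* n ^ (m ∸ 1)) ℕ.* n ^ (m ∸ 1)

  closedForm≥0 : ∀ d → 0ℚ ℚ.≤ closedForm H d j
  -- Passing through `fullWalkSum` treats d = 0 and d ≥ 1 uniformly.
  closedForm≥0 d = subst (0ℚ ℚ.≤_) (fullWalkSum≡closedForm H d j)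
    (0≤* (fromℕ-≥0 V) (∑-≥0 (sequences n m d) term≥0))

  closedForm≤ : ∀ d → closedForm H d j ℚ.≤ fromℕ ((V ℕ.* n) ℕ.* K ^ d)
  closedForm≤ d = subst₂ ℚ._≤_ (fullWalkSum≡closedForm H d j)
    (trans (sym (fromℕ-homo-* V (length (sequences n m d) ℕ.* walkBound d))) (cong fromℕ count-terms))
    (ℚ.*-monoˡ-≤-nonNeg (fromℕ V) {{ℚ.nonNegative (fromℕ-≥0 V)}}
      (∑-≤ (sequences n m d) (walkBound d) term≤walkBound))
    where
    N = n ^ (m ∸ 1)
    length-sequences : length (sequences n m d) ≡ (n ℕ.* N) ^ d
    length-sequences = trans (length-vectors (cartesianProduct (allFin n) (words n (m ∸ 1))) d)
      (cong (_^ d) (trans (length-cartesianProductWith _,_ (allFin n) (words n (m ∸ 1)))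
        (cong₂ ℕ._*_ (length-tabulate {n = n} id) (length-words n (m ∸ 1)))))
    count-terms : V ℕ.* (length (sequences n m d) ℕ.* walkBound d) ≡ (V ℕ.* n) ℕ.* K ^ d
    count-terms = begin
      V ℕ.* (length (sequences n m d) ℕ.* (n ℕ.* n ^ (d ℕ.* (m ∸ 1))))
        ≡⟨ cong₂ (λ x y → V ℕ.* (x ℕ.* (n ℕ.* y))) length-sequences
             (trans (cong (n ^_) (ℕ.*-comm d (m ∸ 1))) (sym (ℕ.^-*-assoc n (m ∸ 1) d))) ⟩
      V ℕ.* ((n ℕ.* N) ^ d ℕ.* (n ℕ.* N ^ d))
        ≡⟨ cong (V ℕ.*_) (ℕ∑.*-leftSwap ((n ℕ.* N) ^ d) n (N ^ d)) ⟩
      V ℕ.* (n ℕ.* ((n ℕ.* N) ^ d ℕ.* N ^ d))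
        ≡⟨ ℕ.*-assoc V n _ ⟨
      (V ℕ.* n) ℕ.* ((n ℕ.* N) ^ d ℕ.* N ^ d)
        ≡⟨ cong ((V ℕ.* n) ℕ.*_) (^-distribʳ-* d (n ℕ.* N) N) ⟨
      (V ℕ.* n) ℕ.* K ^ d ∎

  -- Doubling K leaves room for the factor 2^d: K^d 2^d = x^d ≤ x^x d !, so the d-th term of the
  -- series is at most B / 2^d.
  x B : ℕ
  x = K ℕ.* 2
  B = (V ℕ.* n) ℕ.* x ^ x

  1/!≥0 : ∀ d → 0ℚ ℚ.≤ 1/ d !
  1/!≥0 d = 0≤+/ 1 (d !) {{d ℕ.!≢0}}

  series-bound : ∀ d → (closedForm H d j * 1/ d !) * fromℕ (2 ^ d) ℚ.≤ fromℕ B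
  series-bound d = ℚ.≤-trans
    (ℚ.*-monoʳ-≤-nonNeg (fromℕ (2 ^ d)) {{ℚ.nonNegative (fromℕ-≥0 (2 ^ d))}}
      (ℚ.*-monoʳ-≤-nonNeg (1/ d !) {{ℚ.nonNegative (1/!≥0 d)}} (closedForm≤ d)))
    (subst₂ ℚ._≤_ regroup cancel
      (ℚ.*-monoʳ-≤-nonNeg (1/ d !) {{ℚ.nonNegative (1/!≥0 d)}} (fromℕ-mono-≤ natural)))
    where
    M = (V ℕ.* n) ℕ.* K ^ d

    natural : M ℕ.* 2 ^ d ≤ B ℕ.* d !
    natural = subst₂ _≤_
      (trans (cong ((V ℕ.* n) ℕ.*_) (^-distribʳ-* d K 2)) (sym (ℕ.*-assoc (V ℕ.* n) (K ^ d) (2 ^ d))))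
      (sym (ℕ.*-assoc (V ℕ.* n) (x ^ x) (d !)))
      (ℕ.*-monoʳ-≤ (V ℕ.* n) (x^d≤x^x*d! x d))

    regroup : fromℕ (M ℕ.* 2 ^ d) * 1/ d ! ≡ (fromℕ M * 1/ d !) * fromℕ (2 ^ d)
    regroup = begin
      fromℕ (M ℕ.* 2 ^ d) * 1/ d !          ≡⟨ cong (_* 1/ d !) (fromℕ-homo-* M (2 ^ d)) ⟩
      (fromℕ M * fromℕ (2 ^ d)) * 1/ d !    ≡⟨ ℚ.*-assoc (fromℕ M) (fromℕ (2 ^ d)) (1/ d !) ⟩
      fromℕ M * (fromℕ (2 ^ d) * 1/ d !)    ≡⟨ cong (fromℕ M *_) (ℚ.*-comm (fromℕ (2 ^ d)) (1/ d !)) ⟩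
      fromℕ M * (1/ d ! * fromℕ (2 ^ d))    ≡⟨ ℚ.*-assoc (fromℕ M) (1/ d !) (fromℕ (2 ^ d)) ⟨
      (fromℕ M * 1/ d !) * fromℕ (2 ^ d)    ∎

    cancel : fromℕ (B ℕ.* d !) * 1/ d ! ≡ fromℕ B
    cancel = begin
      fromℕ (B ℕ.* d !) * 1/ d !            ≡⟨ cong (_* 1/ d !) (fromℕ-homo-* B (d !)) ⟩
      (fromℕ B * fromℕ (d !)) * 1/ d !      ≡⟨ ℚ.*-assoc (fromℕ B) (fromℕ (d !)) (1/ d !) ⟩
      fromℕ B * (fromℕ (d !) * 1/ d !)      ≡⟨ cong (fromℕ B *_) (trans (ℚ.*-comm (fromℕ (d !)) (1/ d !)) (/-* 1 (d !) {{d ℕ.!≢0}})) ⟩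
      fromℕ B * 1ℚ                          ≡⟨ ℚ.*-identityʳ (fromℕ B) ⟩
      fromℕ B                               ∎

  centrality : ℝ
  centrality = record
    { approx = partialSum (λ d → closedForm H d j * 1/ d !)
    ; cauchy = partialSum-cauchy (λ d → closedForm H d j * 1/ d !) B
                 (λ d → 0≤* (closedForm≥0 d) (1/!≥0 d)) series-bound
    }

  sumsTo-centrality : (λ d → closedForm H d j * 1/ d !) SumsTo centrality
  -- The real number is represented by the partial sums themselves, so the differences are exactly 0
  -- from index 0 on.
  sumsTo-centrality ε 0<ε = 0 , λ k _ →
    subst (ℚ._< ε) (cong ℚ.∣_∣ (sym (ℚ.+-inverseʳ (partialSum (λ d → closedForm H d j * 1/ d !) k)))) 0<ε

theorem4p2 : ∀ {n m : ℕ} (H : UniformHypergraph n m) (j : Fin n) →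
    (∃[ C ] (IsSubgraphCentrality H j C × ((λ d → closedForm H d j * 1/ d !) SumsTo C))) ×
    (μ H 0 j ≈ const (fromℕ ((m ∸ 1) ^ (n ∸ 1)))) ×
    (∀ d → 1 ≤ d → μ H d j ≈ const (walkSum H d j))
theorem4p2 H j =
  (centrality H j ,
   record { value = λ d → closedForm H d j ; μ≈value = λ d → μ≈closedForm H d j ; sums = sumsTo-centrality H j } ,
   sumsTo-centrality H j) ,
  μ≈closedForm H 0 j ,
  λ { (suc d) _ → μ≈closedForm H (suc d) j }
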